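{- Let $M=\langle W,W^\bot,\preceq,R,V\rangle$ be a $\mathsf{CK}$-model, $w\in W$, and $\varphi$ a well-named $\mu$-sentence. Then: (1) player $\mathsf{I}$ has a winning strategy in the evaluation game $\mathcal G(M,w\models\varphi)$ if and only if $M,w\models\varphi$; and (2) player $\mathsf{II}$ has a winning strategy in $\mathcal G(M,w\models\varphi)$ if and only if $M,w\not\models\varphi$.
   Context: Syntax. $\mu$-formulas over disjoint sets $\mathrm{Prop}$, $\mathrm{Var}$: $\varphi ::= P \mid X \mid \bot \mid \varphi\land\varphi \mid \varphi\lor\varphi \mid \varphi\to\varphi \mid \Box\varphi \mid \Diamond\varphi \mid \mu X.\varphi \mid \nu X.\varphi$, where $\eta X.\varphi$ ($\eta\in\{\mu,\nu\}$) requires $X$ positive in $\varphi$ (every free occurrence of $X$ lies in the antecedent of an even number of implications). A sentence has no free variables. $\varphi$ is well-named if it is guarded (for every subformula $\eta X.\psi$, each occurrence of $X$ in $\psi$ is in the scope of $\Box$ or $\Diamond$) and each bound variable $X$ is bound by only one fixed-point operator $\eta X$ in $\varphi$; then $\psi_X$ denotes the body of that unique subformula $\eta X.\psi_X$. $\mathrm{Sub}(\varphi)$ is the set of subformulas. Semantics. A $\mathsf{CK}$-model: $W\neq\emptyset$, $W^\bot\subseteq W$, $\preceq$ a preorder, $R\subseteq W^2$, $V:\mathrm{Prop}\to\mathcal P(W)$ with each $V(P)$ $\preceq$-upward closed and containing $W^\bot$, and $W^\bot$ closed under $\preceq$ and $R$. $\|P\|=V(P)$, $\|\bot\|=W^\bot$,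 $\land,\lor$ as intersection/union; $w\models\varphi\to\psi$ iff for all $v\succeq w$, $v\models\varphi$ implies $v\models\psi$; $w\models\Box\varphi$ iff $u\models\varphi$ whenever $w\preceq v R u$; $w\models\Diamond\varphi$ iff for all $v\succeq w$ there is $u$ with $vRu$, $u\models\varphi$; $\|\mu X.\varphi\|$, $\|\nu X.\varphi\|$ are the least/greatest fixed points of $A\mapsto\|\varphi\|^{M[X\mapsto A]}$ ($M[X\mapsto A]$ interprets $X$ as $A$). Game $\mathcal G(M,w\models\varphi)$. Two players $\mathsf I,\mathsf{II}$; roles Verifier ($\mathsf V$) and Refuter ($\mathsf R$); $\bar{\mathsf Q}$ is the role dual to $\mathsf Q$. Positions: $\langle v,\psi,\mathsf Q\rangle$ with $v\in W$, $\psi\in\mathrm{Sub}(\varphi)$; auxiliary $\langle v,\hat\Diamond\psi,\mathsf Q\rangle$ for $\Diamond\psi\in\mathrm{Sub}(\varphi)$ and $\langle v,\psi?\theta,\mathsf Q\rangle$ for $\psi\to\theta\in\mathrm{Sub}(\varphi)$; $\mathsf Q$ is $\mathsf I$'s current role and $\mathsf{II}$ has $\bar{\mathsf Q}$. Each position is assigned to a role and is owned by the player currently holding that role; the owner chooses among the admissible moves. Positions of role $\mathsf V$: $\langle v,P,\mathsf Q\rangle$ with $v\notin V(P)$ (no moves); $\langle v,\bot,\mathsf Q\rangle$ with $v\notin W^\bot$ (no moves); $\langle v,\psi\lor\theta,\mathsf Q\rangle\to\langle v,\psi,\mathsf Q\rangle$ or $\langle v,\theta,\mathsf Q\rangle$;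 $\langle v,\psi?\theta,\mathsf Q\rangle\to\langle v,\psi,\bar{\mathsf Q}\rangle$ or $\langle v,\theta,\mathsf Q\rangle$; $\langle v,\hat\Diamond\psi,\mathsf Q\rangle\to\langle u,\psi,\mathsf Q\rangle$ with $vRu$; $\langle v,\mu X.\psi_X,\mathsf Q\rangle\to\langle v,\psi_X,\mathsf Q\rangle$; $\langle v,X,\mathsf Q\rangle\to\langle v,\mu X.\psi_X,\mathsf Q\rangle$ ($X$ bound by $\mu$). Positions of role $\mathsf R$: $\langle v,P,\mathsf Q\rangle$ with $v\in V(P)$ (no moves); $\langle v,\bot,\mathsf Q\rangle$ with $v\in W^\bot$ (no moves); $\langle v,\psi\land\theta,\mathsf Q\rangle\to\langle v,\psi,\mathsf Q\rangle$ or $\langle v,\theta,\mathsf Q\rangle$; $\langle v,\psi\to\theta,\mathsf Q\rangle\to\langle u,\psi?\theta,\mathsf Q\rangle$ with $v\preceq u$; $\langle v,\Box\psi,\mathsf Q\rangle\to\langle u,\psi,\mathsf Q\rangle$ with $v\preceq v'Ru$ for some $v'$; $\langle v,\Diamond\psi,\mathsf Q\rangle\to\langle u,\hat\Diamond\psi,\mathsf Q\rangle$ with $v\preceq u$; $\langle v,\nu X.\psi_X,\mathsf Q\rangle\to\langle v,\psi_X,\mathsf Q\rangle$; $\langle v,X,\mathsf Q\rangle\to\langle v,\nu X.\psi_X,\mathsf Q\rangle$ ($X$ bound by $\nu$). The game starts at $\langle w,\varphi,\mathsf V\rangle$. A run is a sequence of positions from the start, each an admissible move from the previous, either infinite or ending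 at a position with no admissible move; in the latter case the owner of the last position loses. A move $\langle v,X,\mathsf Q\rangle\to\langle v,\eta X.\psi_X,\mathsf Q\rangle$ regenerates $\eta X.\psi_X$. The fixed-point formula $\eta X.\psi_X$ is owned by $\mathsf I$ if some position $\langle v,\eta X.\psi_X,\mathsf Q\rangle$ is reachable from the start with ($\mathsf Q=\mathsf V$ and $\eta=\nu$) or ($\mathsf Q=\mathsf R$ and $\eta=\mu$), and owned by $\mathsf{II}$ otherwise. An infinite run is won by $\mathsf I$ iff $\mathsf I$ owns the outermost fixed-point formula regenerated infinitely often (the one having all other infinitely often regenerated fixed-point formulas as subformulas). A (positional) strategy for a player maps each position owned by that player having an admissible move to an admissible move; it is winning if the player wins every run in which they follow it. -}

module Defs where

open import Level using (0ℓ)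
open import Data.Bool using (Bool; true; false; T; not)
open import Data.Nat using (ℕ; zero; suc; _≤_; _<_)
open import Data.Product using (Σ; Σ-syntax; _×_; _,_)
open import Data.Sum using (_⊎_)
open import Data.Empty using (⊥)
open import Data.List using (List; []; _∷_; _++_)
open import Data.List.Relation.Unary.Unique.Propositional using (Unique)
open import Relation.Nullary using (¬_; yes; no)
open import Relation.Binary.PropositionalEquality using (_≡_; _≢_)
open import Relation.Binary.Definitions using (DecidableEquality)

data FP : Set where
  μ ν : FP

data Fm (Prop Var : Set) : Set where
  atom : Prop → Fm Prop Var
  var  : Var → Fm Prop Var
  ff   : Fm Prop Var
  _∧ᶠ_ _∨ᶠ_ _⇒ᶠ_ : Fm Prop Var → Fm Prop Var → Fm Prop Var
  □ᶠ ◇ᶠ : Fm Prop Var → Fm Prop Var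
  fix  : FP → Var → Fm Prop Var → Fm Prop Var

module _ {Prop Var : Set} where

  data _⊑_ : Fm Prop Var → Fm Prop Var → Set where
    here : ∀ {φ} → φ ⊑ φ
    ∧l   : ∀ {ψ a b} → ψ ⊑ a → ψ ⊑ (a ∧ᶠ b)
    ∧r   : ∀ {ψ a b} → ψ ⊑ b → ψ ⊑ (a ∧ᶠ b)
    ∨l   : ∀ {ψ a b} → ψ ⊑ a → ψ ⊑ (a ∨ᶠ b)
    ∨r   : ∀ {ψ a b} → ψ ⊑ b → ψ ⊑ (a ∨ᶠ b)
    ⇒l   : ∀ {ψ a b} → ψ ⊑ a → ψ ⊑ (a ⇒ᶠ b)
    ⇒r   : ∀ {ψ a b} → ψ ⊑ b → ψ ⊑ (a ⇒ᶠ b)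
    □s   : ∀ {ψ a} → ψ ⊑ a → ψ ⊑ (□ᶠ a)
    ◇s   : ∀ {ψ a} → ψ ⊑ a → ψ ⊑ (◇ᶠ a)
    fixs : ∀ {ψ η X a} → ψ ⊑ a → ψ ⊑ fix η X a

  -- FreeOcc X φ b : a free occurrence of X in φ lying in the antecedent of
  -- an odd (b = true) / even (b = false) number of implications
  data FreeOcc (X : Var) : Fm Prop Var → Bool → Set where
    here : FreeOcc X (var X) false
    ∧l   : ∀ {a b p} → FreeOcc X a p → FreeOcc X (a ∧ᶠ b) p
    ∧r   : ∀ {a b p} → FreeOcc X b p → FreeOcc X (a ∧ᶠ b) p
    ∨l   : ∀ {a b p} → FreeOcc X a p → FreeOcc X (a ∨ᶠ b) p
    ∨r   : ∀ {a b p} → FreeOcc X b p → FreeOcc X (a ∨ᶠ b) p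
    ⇒l   : ∀ {a b p} → FreeOcc X a p → FreeOcc X (a ⇒ᶠ b) (not p)
    ⇒r   : ∀ {a b p} → FreeOcc X b p → FreeOcc X (a ⇒ᶠ b) p
    □s   : ∀ {a p} → FreeOcc X a p → FreeOcc X (□ᶠ a) p
    ◇s   : ∀ {a p} → FreeOcc X a p → FreeOcc X (◇ᶠ a) p
    fixs : ∀ {η Y a p} → Y ≢ X → FreeOcc X a p → FreeOcc X (fix η Y a) p

  Positive : Var → Fm Prop Var → Set
  Positive X φ = ∀ {p} → FreeOcc X φ p → p ≡ false

  MuFormula : Fm Prop Var → Set
  MuFormula φ = ∀ {η X ψ} → fix η X ψ ⊑ φ → Positive X ψ

  Sentence : Fm Prop Var → Set
  Sentence φ = ∀ X p → ¬ FreeOcc X φ p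

  data Unguarded (X : Var) : Fm Prop Var → Set where
    here : Unguarded X (var X)
    ∧l   : ∀ {a b} → Unguarded X a → Unguarded X (a ∧ᶠ b)
    ∧r   : ∀ {a b} → Unguarded X b → Unguarded X (a ∧ᶠ b)
    ∨l   : ∀ {a b} → Unguarded X a → Unguarded X (a ∨ᶠ b)
    ∨r   : ∀ {a b} → Unguarded X b → Unguarded X (a ∨ᶠ b)
    ⇒l   : ∀ {a b} → Unguarded X a → Unguarded X (a ⇒ᶠ b)
    ⇒r   : ∀ {a b} → Unguarded X b → Unguarded X (a ⇒ᶠ b)
    fixs : ∀ {η Y a} → Y ≢ X → Unguarded X a → Unguarded X (fix η Y a)

  Guarded : Fm Prop Var → Set
  Guarded φ = ∀ {η X ψ} → fix η X ψ ⊑ φ → ¬ Unguarded X ψ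

  binders : Fm Prop Var → List Var
  binders (atom P)   = []
  binders (var X)    = []
  binders ff         = []
  binders (a ∧ᶠ b)   = binders a ++ binders b
  binders (a ∨ᶠ b)   = binders a ++ binders b
  binders (a ⇒ᶠ b)   = binders a ++ binders b
  binders (□ᶠ a)     = binders a
  binders (◇ᶠ a)     = binders a
  binders (fix η X a) = X ∷ binders a

  WellNamed : Fm Prop Var → Set
  WellNamed φ = Guarded φ × Unique (binders φ)

record CKModel (Prop : Set) : Set₁ where
  field
    W        : Set
    nonempty : W
    W⊥       : W → Set
    _≼_      : W → W → Set
    R        : W → W → Set
    V        : Prop → W → Set
    ≼-refl   : ∀ {w} → w ≼ w
    ≼-trans  : ∀ {u v w} → u ≼ v → v ≼ w → u ≼ w
    V-up     : ∀ P {v w} → v ≼ w → V P v → V P w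
    V-⊥      : ∀ P {w} → W⊥ w → V P w
    W⊥-≼     : ∀ {v w} → v ≼ w → W⊥ v → W⊥ w
    W⊥-R     : ∀ {v w} → R v w → W⊥ v → W⊥ w

-- Semantics. Subsets quantified over in the fixed-point clauses are given
-- by characteristic functions W → Bool.

module Semantics {Prop Var : Set} (_≟_ : DecidableEquality Var)
                 (M : CKModel Prop) where
  open CKModel M

  Env : Set₁
  Env = Var → W → Set

  _[_↦_] : Env → Var → (W → Set) → Env
  (ρ [ X ↦ A ]) Y with X ≟ Y
  ... | yes _ = A
  ... | no  _ = ρ Y

  ⟦_⟧ : Fm Prop Var → Env → W → Set
  ⟦ atom P ⟧ ρ w = V P w
  ⟦ var X ⟧ ρ w = ρ X w
  ⟦ ff ⟧ ρ w = W⊥ w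
  ⟦ a ∧ᶠ b ⟧ ρ w = ⟦ a ⟧ ρ w × ⟦ b ⟧ ρ w
  ⟦ a ∨ᶠ b ⟧ ρ w = ⟦ a ⟧ ρ w ⊎ ⟦ b ⟧ ρ w
  ⟦ a ⇒ᶠ b ⟧ ρ w = ∀ v → w ≼ v → ⟦ a ⟧ ρ v → ⟦ b ⟧ ρ v
  ⟦ □ᶠ a ⟧ ρ w = ∀ v u → w ≼ v → R v u → ⟦ a ⟧ ρ u
  ⟦ ◇ᶠ a ⟧ ρ w = ∀ v → w ≼ v → Σ[ u ∈ W ] (R v u × ⟦ a ⟧ ρ u)
  -- least fixed point: intersection of all pre-fixed points
  ⟦ fix μ X a ⟧ ρ w =
    (A : W → Bool) →
    (∀ v → ⟦ a ⟧ (ρ [ X ↦ (λ u → T (A u)) ]) v → T (A v)) → T (A w)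
  -- greatest fixed point: union of all post-fixed points
  ⟦ fix ν X a ⟧ ρ w =
    Σ[ A ∈ (W → Bool) ]
      ((∀ v → T (A v) → ⟦ a ⟧ (ρ [ X ↦ (λ u → T (A u)) ]) v) × T (A w))

  emptyEnv : Env
  emptyEnv _ _ = ⊥

  -- M, w ⊨ φ  (for sentences the environment is irrelevant)
  _⊨_ : W → Fm Prop Var → Set
  w ⊨ φ = ⟦ φ ⟧ emptyEnv w

data Role : Set where
  Vᵣ Rᵣ : Role

dual : Role → Role
dual Vᵣ = Rᵣ
dual Rᵣ = Vᵣ

data Player : Set where
  I II : Player

other : Player → Player
other I  = II
other II = I

-- holder Q r : the player holding role r when player I holds role Q
holder : Role → Role → Player
holder Vᵣ Vᵣ = I
holder Rᵣ Rᵣ = I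
holder Vᵣ Rᵣ = II
holder Rᵣ Vᵣ = II

module Game {Prop Var : Set} (M : CKModel Prop) (φ : Fm Prop Var)
            (w : CKModel.W M) where
  open CKModel M

  data Pos : Set where
    pos  : W → Fm Prop Var → Role → Pos
    dpos : W → Fm Prop Var → Role → Pos
    ipos : W → Fm Prop Var → Fm Prop Var → Role → Pos

  roleI : Pos → Role
  roleI (pos _ _ Q)    = Q
  roleI (dpos _ _ Q)   = Q
  roleI (ipos _ _ _ Q) = Q

  data InGame : Pos → Set where
    pos  : ∀ {v ψ Q} → ψ ⊑ φ → InGame (pos v ψ Q)
    dpos : ∀ {v ψ Q} → ◇ᶠ ψ ⊑ φ → InGame (dpos v ψ Q)
    ipos : ∀ {v ψ θ Q} → (ψ ⇒ᶠ θ) ⊑ φ → InGame (ipos v ψ θ Q)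

  data Move : Pos → Pos → Set where
    ∨l     : ∀ {v a b Q} → Move (pos v (a ∨ᶠ b) Q) (pos v a Q)
    ∨r     : ∀ {v a b Q} → Move (pos v (a ∨ᶠ b) Q) (pos v b Q)
    ?l     : ∀ {v a b Q} → Move (ipos v a b Q) (pos v a (dual Q))
    ?r     : ∀ {v a b Q} → Move (ipos v a b Q) (pos v b Q)
    ◇̂m     : ∀ {v u a Q} → R v u → Move (dpos v a Q) (pos u a Q)
    unfold : ∀ {v η X a Q} → Move (pos v (fix η X a) Q) (pos v a Q)
    regen  : ∀ {v η X a Q} → fix η X a ⊑ φ →
             Move (pos v (var X) Q) (pos v (fix η X a) Q)
    ∧l     : ∀ {v a b Q} → Move (pos v (a ∧ᶠ b) Q) (pos v a Q)
    ∧r     : ∀ {v a b Q} → Move (pos v (a ∧ᶠ b) Q) (pos v b Q)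
    ⇒m     : ∀ {v u a b Q} → v ≼ u → Move (pos v (a ⇒ᶠ b) Q) (ipos u a b Q)
    □m     : ∀ {v v′ u a Q} → v ≼ v′ → R v′ u → Move (pos v (□ᶠ a) Q) (pos u a Q)
    ◇m     : ∀ {v u a Q} → v ≼ u → Move (pos v (◇ᶠ a) Q) (dpos u a Q)

  data RoleOf : Pos → Role → Set where
    atomV : ∀ {v P Q} → ¬ V P v → RoleOf (pos v (atom P) Q) Vᵣ
    ffV   : ∀ {v Q} → ¬ W⊥ v → RoleOf (pos v ff Q) Vᵣ
    ∨V    : ∀ {v a b Q} → RoleOf (pos v (a ∨ᶠ b) Q) Vᵣ
    ?V    : ∀ {v a b Q} → RoleOf (ipos v a b Q) Vᵣ
    ◇̂V    : ∀ {v a Q} → RoleOf (dpos v a Q) Vᵣ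
    μV    : ∀ {v X a Q} → RoleOf (pos v (fix μ X a) Q) Vᵣ
    varμ  : ∀ {v X a Q} → fix μ X a ⊑ φ → RoleOf (pos v (var X) Q) Vᵣ
    atomR : ∀ {v P Q} → V P v → RoleOf (pos v (atom P) Q) Rᵣ
    ffR   : ∀ {v Q} → W⊥ v → RoleOf (pos v ff Q) Rᵣ
    ∧R    : ∀ {v a b Q} → RoleOf (pos v (a ∧ᶠ b) Q) Rᵣ
    ⇒R    : ∀ {v a b Q} → RoleOf (pos v (a ⇒ᶠ b) Q) Rᵣ
    □R    : ∀ {v a Q} → RoleOf (pos v (□ᶠ a) Q) Rᵣ
    ◇R    : ∀ {v a Q} → RoleOf (pos v (◇ᶠ a) Q) Rᵣ
    νR    : ∀ {v X a Q} → RoleOf (pos v (fix ν X a) Q) Rᵣ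
    varν  : ∀ {v X a Q} → fix ν X a ⊑ φ → RoleOf (pos v (var X) Q) Rᵣ

  Owns : Player → Pos → Set
  Owns pl p = Σ[ r ∈ Role ] (RoleOf p r × holder (roleI p) r ≡ pl)

  start : Pos
  start = pos w φ Vᵣ

  data Reach : Pos → Set where
    reach0 : Reach start
    step  : ∀ {p q} → Reach p → Move p q → Reach q

  data IOwnCond : Fm Prop Var → Role → Set where
    νV : ∀ {X a} → IOwnCond (fix ν X a) Vᵣ
    μR : ∀ {X a} → IOwnCond (fix μ X a) Rᵣ

  IOwnsFP : Fm Prop Var → Set
  IOwnsFP θ = Σ[ v ∈ W ] Σ[ Q ∈ Role ] (Reach (pos v θ Q) × IOwnCond θ Q)

  OwnsFP : Fm Prop Var → Player → Set
  OwnsFP θ I  = IOwnsFP θ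
  OwnsFP θ II = ¬ IOwnsFP θ

  Regen : (ℕ → Pos) → ℕ → Fm Prop Var → Set
  Regen f n θ =
    Σ[ v ∈ W ] Σ[ X ∈ Var ] Σ[ Q ∈ Role ] Σ[ η ∈ FP ] Σ[ a ∈ Fm Prop Var ]
      (θ ≡ fix η X a × f n ≡ pos v (var X) Q × f (suc n) ≡ pos v θ Q)

  InfRegen : (ℕ → Pos) → Fm Prop Var → Set
  InfRegen f θ = ∀ N → Σ[ n ∈ ℕ ] (N ≤ n × Regen f n θ)

  FinRun : ℕ → (ℕ → Pos) → Set
  FinRun n f = f 0 ≡ start × (∀ i → i < n → Move (f i) (f (suc i)))
             × ¬ (Σ[ q ∈ Pos ] Move (f n) q)

  InfRun : (ℕ → Pos) → Set
  InfRun f = f 0 ≡ start × (∀ i → Move (f i) (f (suc i)))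

  WinsFin : Player → ℕ → (ℕ → Pos) → Set
  WinsFin pl n f = Owns (other pl) (f n)

  WinsInf : Player → (ℕ → Pos) → Set
  WinsInf pl f = Σ[ θ ∈ Fm Prop Var ]
    (InfRegen f θ × (∀ θ′ → InfRegen f θ′ → θ′ ⊑ θ) × OwnsFP θ pl)

  Strategy : Player → (Pos → Pos) → Set
  Strategy pl σ = ∀ p → InGame p → Owns pl p → Σ[ q ∈ Pos ] Move p q → Move p (σ p)

  FollowsFin : Player → (Pos → Pos) → ℕ → (ℕ → Pos) → Set
  FollowsFin pl σ n f = ∀ i → i < n → Owns pl (f i) → f (suc i) ≡ σ (f i)

  FollowsInf : Player → (Pos → Pos) → (ℕ → Pos) → Set
  FollowsInf pl σ f = ∀ i → Owns pl (f i) → f (suc i) ≡ σ (f i)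

  WinningStrategy : Player → (Pos → Pos) → Set
  WinningStrategy pl σ =
    Strategy pl σ
    × (∀ n f → FinRun n f → FollowsFin pl σ n f → WinsFin pl n f)
    × (∀ f → InfRun f → FollowsInf pl σ f → WinsInf pl f)

  HasWinningStrategy : Player → Set
  HasWinningStrategy pl = Σ[ σ ∈ (Pos → Pos) ] WinningStrategy pl σ

{-# OPTIONS --safe #-}
module Submission where

-- Memoryless strategies from signatures. Fix a player and call a fixed point
-- losing if regenerating it forever loses for that player. Listing the binders
-- of φ in preorder, a signature assigns to each of them an ordinal; under a
-- signature, a losing bound variable denotes the approximant of that stage, any
-- other bound variable its exact fixed point. From a position whose claim is
-- true for the player, move so that the lexicographically least signature making
-- the claim true does not increase. Regenerating the outermost recurring fixed
-- point resets only components after it, so if it were losing, its component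
-- would decrease forever. Truth at the start thus gives a winning strategy to I,
-- falsity to II, and two winning strategies cannot coexist.

open import Defs
open import Level using (0ℓ)
open import Axiom.ExcludedMiddle using (ExcludedMiddle)
open import Data.Bool using (Bool; true; false; T; not)
open import Data.Empty using (⊥; ⊥-elim)
open import Data.List using (List; []; _∷_; length; map; _ʳ++_)
open import Data.List.Membership.Propositional using (_∈_)
open import Data.List.Properties using (++-ʳ++)
open import Data.List.Relation.Binary.Permutation.Propositional using (↭-sym; ↭⇒↭ₛ)
open import Data.List.Relation.Binary.Permutation.Propositional.Properties using (↭-reverse)
open import Data.List.Relation.Binary.Permutation.Setoid.Properties using (Unique-resp-↭)
open import Data.List.Relation.Unary.All using (lookup)
open import Data.List.Relation.Unary.AllPairs using (_∷_)
open import Data.List.Relation.Unary.Any using (here; there)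
open import Data.List.Relation.Unary.Unique.Propositional using (Unique)
open import Data.Nat using (ℕ; zero; suc; _+_; _<_; _≤_; _⊔_; s≤s; s≤s⁻¹)
open import Data.Nat.Properties using (≤-refl; ≤-trans; <-≤-trans; <-irrefl; <⇒≤; n≤1+n; m≤m+n; m≤n+m; m≤m⊔n; m≤n⊔m; m≤n⇒m≤1+n; m≤n⇒m<n∨m≡n)
open import Data.Product using (Σ; Σ-syntax; _×_; _,_; proj₁; proj₂)
open import Data.Sum as Sum using (_⊎_; inj₁; inj₂; [_,_]′)
open import Data.Unit using (⊤; tt)
open import Function using (id; _∘_)
open import Function.Bundles using (_⇔_; mk⇔)
open import Induction.WellFounded using (Acc; acc; WellFounded)
open import Relation.Binary.Definitions using (DecidableEquality)
open import Relation.Binary.PropositionalEquality using (_≡_; _≢_; refl; sym; trans; cong; subst; subst₂; setoid)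
open import Relation.Nullary using (¬_; yes; no; isYes; contradiction)
open import Relation.Nullary.Decidable using (decidable-stable; toWitness; fromWitness)

-- Well-founded total preorders and tree ordinals

-- Implication exchanges the roles, so whether a fixed point is losing depends on the role with
-- which it is reached. Two hypotheses turn this into a property of the binder: distinct binders
-- leave a single occurrence of each fixed-point formula, and positivity puts every bound variable,
-- counted from its binder, under an even number of antecedents, so that regeneration returns with
-- the binder's role. The role is therefore stored with the binder, and truth and falsity, least and
-- greatest fixed points are treated by the same statements with a Boolean parameter. A positional
-- strategy cannot carry a signature along the play, so the least one is recomputed at each
-- position. All positions share signatures over one list of binders, whatever is in scope, so that
-- those of neighbouring positions can be compared directly.

record WellPreorder : Set₁ where
  field
    Carrier : Set
    _≼_ _≺_ : Carrier → Carrier → Set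
    ≼-refl  : ∀ {x} → x ≼ x
    ≼-trans : ∀ {x y z} → x ≼ y → y ≼ z → x ≼ z
    ≺-≼-trans : ∀ {x y z} → x ≺ y → y ≼ z → x ≺ z
    ≼-≺-trans : ∀ {x y z} → x ≼ y → y ≺ z → x ≺ z
    ≺⇒≼     : ∀ {x y} → x ≺ y → x ≼ y
    compare : ∀ x y → x ≼ y ⊎ y ≺ x
    wf      : WellFounded _≺_

unitOrder : WellPreorder
unitOrder = record
  { Carrier = ⊤ ; _≼_ = λ _ _ → ⊤ ; _≺_ = λ _ _ → ⊥
  ; ≼-refl = tt ; ≼-trans = λ _ _ → tt
  ; ≺-≼-trans = λ () ; ≼-≺-trans = λ _ () ; ≺⇒≼ = λ ()
  ; compare = λ _ _ → inj₁ tt ; wf = λ _ → acc λ ()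
  }

-- The second component is the more significant one.
lexOrder : WellPreorder → WellPreorder → WellPreorder
lexOrder A B = record
  { Carrier = A.Carrier × B.Carrier
  ; _≼_ = _≼_ ; _≺_ = _≺_
  ; ≼-refl = inj₂ (B.≼-refl , A.≼-refl)
  ; ≼-trans = ≼-trans ; ≺-≼-trans = ≺-≼-trans ; ≼-≺-trans = ≼-≺-trans
  ; ≺⇒≼ = ≺⇒≼ ; compare = compare
  ; wf = λ (a , b) → access b (B.wf b) a (A.wf a) B.≼-refl
  }
  where
  module A = WellPreorder A
  module B = WellPreorder B
  C = A.Carrier × B.Carrier

  _≼_ _≺_ : C → C → Set
  (a , b) ≼ (a′ , b′) = b B.≺ b′ ⊎ (b B.≼ b′ × a A.≼ a′)
  (a , b) ≺ (a′ , b′) = b B.≺ b′ ⊎ (b B.≼ b′ × a A.≺ a′)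

  ≼-trans : ∀ {x y z} → x ≼ y → y ≼ z → x ≼ z
  ≼-trans (inj₁ p)       (inj₁ q)       = inj₁ (B.≺-≼-trans p (B.≺⇒≼ q))
  ≼-trans (inj₁ p)       (inj₂ (q , _)) = inj₁ (B.≺-≼-trans p q)
  ≼-trans (inj₂ (p , _)) (inj₁ q)       = inj₁ (B.≼-≺-trans p q)
  ≼-trans (inj₂ (p , r)) (inj₂ (q , s)) = inj₂ (B.≼-trans p q , A.≼-trans r s)

  ≺-≼-trans : ∀ {x y z} → x ≺ y → y ≼ z → x ≺ z
  ≺-≼-trans (inj₁ p)       (inj₁ q)       = inj₁ (B.≺-≼-trans p (B.≺⇒≼ q))
  ≺-≼-trans (inj₁ p)       (inj₂ (q , _)) = inj₁ (B.≺-≼-trans p q)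
  ≺-≼-trans (inj₂ (p , _)) (inj₁ q)       = inj₁ (B.≼-≺-trans p q)
  ≺-≼-trans (inj₂ (p , r)) (inj₂ (q , s)) = inj₂ (B.≼-trans p q , A.≺-≼-trans r s)

  ≼-≺-trans : ∀ {x y z} → x ≼ y → y ≺ z → x ≺ z
  ≼-≺-trans (inj₁ p)       (inj₁ q)       = inj₁ (B.≺-≼-trans p (B.≺⇒≼ q))
  ≼-≺-trans (inj₁ p)       (inj₂ (q , _)) = inj₁ (B.≺-≼-trans p q)
  ≼-≺-trans (inj₂ (p , _)) (inj₁ q)       = inj₁ (B.≼-≺-trans p q)
  ≼-≺-trans (inj₂ (p , r)) (inj₂ (q , s)) = inj₂ (B.≼-trans p q , A.≼-≺-trans r s)

  ≺⇒≼ : ∀ {x y} → x ≺ y → x ≼ y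
  ≺⇒≼ (inj₁ p)       = inj₁ p
  ≺⇒≼ (inj₂ (p , q)) = inj₂ (p , A.≺⇒≼ q)

  compare : ∀ x y → x ≼ y ⊎ y ≺ x
  compare (a , b) (a′ , b′) with B.compare b b′ | B.compare b′ b | A.compare a a′
  ... | inj₂ p | _      | _      = inj₂ (inj₁ p)
  ... | inj₁ _ | inj₂ q | _      = inj₁ (inj₁ q)
  ... | inj₁ p | inj₁ _ | inj₁ r = inj₁ (inj₂ (p , r))
  ... | inj₁ _ | inj₁ q | inj₂ r = inj₂ (inj₂ (q , r))

  -- b′ below b absorbs the failure of antisymmetry of B.
  access : ∀ b → Acc B._≺_ b → ∀ a → Acc A._≺_ a → ∀ {b′} → b′ B.≼ b → Acc _≺_ (a , b′)
  below : ∀ b → Acc B._≺_ b → ∀ a → Acc A._≺_ a → ∀ {b′} → b′ B.≼ b →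
          ∀ {x} → x ≺ (a , b′) → Acc _≺_ x
  access b ab a aa b′≼b = acc (below b ab a aa b′≼b)
  below b (acc rb) a aa b′≼b {x = a″ , b″} (inj₁ b″≺b′) =
    access b″ (rb (B.≺-≼-trans b″≺b′ b′≼b)) a″ (A.wf a″) B.≼-refl
  below b ab a (acc ra) b′≼b {x = a″ , b″} (inj₂ (b″≼b′ , a″≺a)) =
    access b ab a″ (ra a″≺a) (B.≼-trans b″≼b′ b′≼b)

-- `lim f` plays the least ordinal strictly above every `f i`. Different trees can stand for the
-- same ordinal, which is why only preorders are asked for.
data Ord (J : Set) : Set where
  zero : Ord J
  lim  : (J → Ord J) → Ord J

module _ {J : Set} where

  data _≤ₒ_ : Ord J → Ord J → Set
  data _<ₒ_ : Ord J → Ord J → Set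

  data _≤ₒ_ where
    zero≤ : ∀ {t} → zero ≤ₒ t
    lim≤  : ∀ {f t} → (∀ i → f i <ₒ t) → lim f ≤ₒ t

  data _<ₒ_ where
    <lim : ∀ {s g} i → s ≤ₒ g i → s <ₒ lim g

  ≤ₒ-refl : ∀ {s} → s ≤ₒ s
  ≤ₒ-refl {zero}  = zero≤
  ≤ₒ-refl {lim f} = lim≤ λ i → <lim i ≤ₒ-refl

  ≤ₒ-trans   : ∀ {s t u} → s ≤ₒ t → t ≤ₒ u → s ≤ₒ u
  <ₒ-≤ₒ-trans : ∀ {s t u} → s <ₒ t → t ≤ₒ u → s <ₒ u
  ≤ₒ-<ₒ-trans : ∀ {s t u} → s ≤ₒ t → t <ₒ u → s <ₒ u
  ≤ₒ-trans zero≤    _ = zero≤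
  ≤ₒ-trans (lim≤ p) q = lim≤ λ i → <ₒ-≤ₒ-trans (p i) q
  <ₒ-≤ₒ-trans (<lim i p) (lim≤ q) = ≤ₒ-<ₒ-trans p (q i)
  ≤ₒ-<ₒ-trans p (<lim i q) = <lim i (≤ₒ-trans p q)

  <ₒ⇒≤ₒ : ∀ {s t} → s <ₒ t → s ≤ₒ t
  <ₒ⇒≤ₒ (<lim i zero≤)    = zero≤
  <ₒ⇒≤ₒ (<lim i (lim≤ p)) = lim≤ λ j → <lim i (<ₒ⇒≤ₒ (p j))

  -- Structural recursion on the tree: whatever is below `lim g` is weakly below one branch `g i`,
  -- so everything strictly below it is strictly below `g i`.
  <ₒ-wellFounded : WellFounded (_<ₒ_)
  <ₒ-wellFounded t = acc (below t)
    where
    below : ∀ t {s} → s <ₒ t → Acc _<ₒ_ s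
    below (lim g) (<lim i s≤gi) = acc λ r<s → below (g i) (<ₒ-≤ₒ-trans r<s s≤gi)

-- Excluded middle for sets of witnesses selects a witness, so it also serves
-- as a choice principle throughout.
module Classical (em : ExcludedMiddle 0ℓ) where

  stable : {A : Set} → ¬ ¬ A → A
  stable = decidable-stable em

  compareₒ : ∀ {J} (s t : Ord J) → s ≤ₒ t ⊎ t <ₒ s
  compareₒ zero    t = inj₁ zero≤
  compareₒ (lim f) t with em {P = Σ[ i ∈ _ ] ¬ (f i <ₒ t)}
  ... | no ∄i = inj₁ (lim≤ λ i → stable λ fi≮t → ∄i (i , fi≮t))
  ... | yes (i , fi≮t) with compareₒ t (f i)
  ...   | inj₁ t≤fi = inj₂ (<lim i t≤fi)
  ...   | inj₂ fi<t = ⊥-elim (fi≮t fi<t)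

  ordOrder : Set → WellPreorder
  ordOrder J = record
    { Carrier = Ord J ; _≼_ = _≤ₒ_ ; _≺_ = _<ₒ_
    ; ≼-refl = ≤ₒ-refl ; ≼-trans = ≤ₒ-trans
    ; ≺-≼-trans = <ₒ-≤ₒ-trans ; ≼-≺-trans = ≤ₒ-<ₒ-trans
    ; ≺⇒≼ = <ₒ⇒≤ₒ ; compare = compareₒ ; wf = <ₒ-wellFounded
    }

  module _ (A : WellPreorder) where
    open WellPreorder A

    Minimal : (Carrier → Set) → Carrier → Set
    Minimal P m = P m × (∀ x → P x → m ≼ x)

    minimum : (P : Carrier → Set) → Σ Carrier P → Σ Carrier (Minimal P)
    minimum P (x , px) = go x px (wf x)
      where
      go : ∀ x → P x → Acc _≺_ x → Σ Carrier (Minimal P)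
      go x px (acc rs) with em {P = Σ[ y ∈ Carrier ] (y ≺ x × P y)}
      ... | yes (y , y≺x , py) = go y py (rs y≺x)
      ... | no ∄y = x , px , λ y py →
        [ id , (λ y≺x → ⊥-elim (∄y (y , y≺x , py))) ]′ (compare x y)

  -- The stages from below of the least fixed point of F, indexed by trees
  -- branching over W instead of ordinals.
  appr : {W : Set} → ((W → Set) → W → Set) → Ord W → W → Set
  appr F zero    v = ⊥
  appr F (lim f) v = Σ[ i ∈ _ ] F (appr F (f i)) v

  module Closure {W : Set} (F : (W → Set) → W → Set)
    (F-mono : ∀ {A B} → (∀ u → A u → B u) → ∀ u → F A u → F B u) where

    -- Membership asks for one further application of `F` to a stage. This is the form in which
    -- unfolding a fixed point uses it: β is the stage left to the bound variable.
    appr∞ : W → Set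
    appr∞ v = Σ[ β ∈ Ord W ] F (appr F β) v

    -- Each world of `appr∞` has its own stage, and since trees branch over `W` a single `lim`
    -- bounds all of them. Monotonicity then replaces `appr∞` by that one stage.
    appr∞-prefixed : ∀ v → F appr∞ v → appr∞ v
    appr∞-prefixed v x = lim rank , F-mono (λ u y → u , rank-spec u y) v x
      where
      rank : W → Ord W
      rank u with em {P = appr∞ u}
      ... | yes (β , _) = β
      -- A filler for worlds outside `appr∞`, on which `rank-spec` makes no claim.
      ... | no _        = zero
      rank-spec : ∀ u → appr∞ u → F (appr F (rank u)) u
      rank-spec u y with em {P = appr∞ u}
      ... | yes (_ , z) = z
      ... | no ¬y       = ⊥-elim (¬y y)

-- Denotations and approximants

Holds : Bool → Set → Set
Holds true  A = A
Holds false A = ¬ A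

Holds-map : ∀ b {A B} → (A → B) → (B → A) → Holds b A → Holds b B
Holds-map true  f g x    = f x
Holds-map false f g ¬x y = ¬x (g y)

Losing : Bool → FP → Set
Losing true  μ = ⊤
Losing false ν = ⊤
Losing true  ν = ⊥
Losing false μ = ⊥

module Denotation (em : ExcludedMiddle 0ℓ) {Prop Var : Set}
  (_≟_ : DecidableEquality Var) (M : CKModel Prop) where

  open Classical em
  open CKModel M
  open Semantics _≟_ M

  update-same : ∀ ρ X A → (ρ [ X ↦ A ]) X ≡ A
  update-same ρ X A with X ≟ X
  ... | yes _  = refl
  ... | no X≢X = ⊥-elim (X≢X refl)

  update-other : ∀ ρ {X Y} A → X ≢ Y → (ρ [ X ↦ A ]) Y ≡ ρ Y
  update-other ρ {X} {Y} A X≢Y with X ≟ Y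
  ... | yes X≡Y = ⊥-elim (X≢Y X≡Y)
  ... | no _    = refl

  _⊆_ : (W → Set) → (W → Set) → Set
  A ⊆ B = ∀ v → A v → B v

  update-mono : ∀ {ρ ρ′ A B X Y} → A ⊆ B → (X ≢ Y → ρ Y ⊆ ρ′ Y) →
                (ρ [ X ↦ A ]) Y ⊆ (ρ′ [ X ↦ B ]) Y
  update-mono {X = X} {Y} A⊆B ρ⊆ρ′ with X ≟ Y
  ... | yes _  = A⊆B
  ... | no X≢Y = ρ⊆ρ′ X≢Y

  -- Antecedents swap the two hypotheses. In the fixed-point clauses the same set `A` serves both
  -- environments: a pre-fixed point under `ρ′` is one under `ρ`, a post-fixed point under `ρ` is
  -- one under `ρ′`.
  ⟦⟧-mono : ∀ φ {ρ ρ′} → (∀ {X} → FreeOcc X φ false → ρ X ⊆ ρ′ X) →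
            (∀ {X} → FreeOcc X φ true → ρ′ X ⊆ ρ X) → ⟦ φ ⟧ ρ ⊆ ⟦ φ ⟧ ρ′
  ⟦⟧-mono (atom P)   p n v x = x
  ⟦⟧-mono (var X)    p n v x = p here v x
  ⟦⟧-mono ff         p n v x = x
  ⟦⟧-mono (a ∧ᶠ b)   p n v (x , y) =
    ⟦⟧-mono a (p ∘ ∧l) (n ∘ ∧l) v x , ⟦⟧-mono b (p ∘ ∧r) (n ∘ ∧r) v y
  ⟦⟧-mono (a ∨ᶠ b)   p n v (inj₁ x) = inj₁ (⟦⟧-mono a (p ∘ ∨l) (n ∘ ∨l) v x)
  ⟦⟧-mono (a ∨ᶠ b)   p n v (inj₂ y) = inj₂ (⟦⟧-mono b (p ∘ ∨r) (n ∘ ∨r) v y)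
  ⟦⟧-mono (a ⇒ᶠ b)   p n v f u v≼u x =
    ⟦⟧-mono b (p ∘ ⇒r) (n ∘ ⇒r) u (f u v≼u (⟦⟧-mono a (n ∘ ⇒l) (p ∘ ⇒l) u x))
  ⟦⟧-mono (□ᶠ a)     p n v f u t v≼u uRt = ⟦⟧-mono a (p ∘ □s) (n ∘ □s) t (f u t v≼u uRt)
  ⟦⟧-mono (◇ᶠ a)     p n v f u v≼u with f u v≼u
  ... | t , uRt , x = t , uRt , ⟦⟧-mono a (p ∘ ◇s) (n ∘ ◇s) t x
  ⟦⟧-mono (fix μ X a) p n v f A pre = f A λ u x → pre u
    (⟦⟧-mono a (λ o → update-mono (λ _ z → z) (λ X≢Y → p (fixs X≢Y o)))
               (λ o → update-mono (λ _ z → z) (λ X≢Y → n (fixs X≢Y o))) u x)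
  ⟦⟧-mono (fix ν X a) p n v (A , post , x) = A , (λ u y →
    ⟦⟧-mono a (λ o → update-mono (λ _ z → z) (λ X≢Y → p (fixs X≢Y o)))
              (λ o → update-mono (λ _ z → z) (λ X≢Y → n (fixs X≢Y o))) u (post u y)) , x

  ⟦⟧-cong : ∀ b φ {ρ ρ′} → (∀ {X p} → FreeOcc X φ p → ρ X ≡ ρ′ X) →
            ∀ {v} → Holds b (⟦ φ ⟧ ρ v) → Holds b (⟦ φ ⟧ ρ′ v)
  ⟦⟧-cong b φ {ρ} {ρ′} eq {v} = Holds-map b
    (⟦⟧-mono φ (λ o → incl (eq o)) (λ o → incl (sym (eq o))) v)
    (⟦⟧-mono φ (λ o → incl (sym (eq o))) (λ o → incl (eq o)) v)
    where
    incl : ∀ {A B : W → Set} → A ≡ B → A ⊆ B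
    incl refl _ x = x

  -- The fixed-point clauses range over Boolean subsets; excluded middle makes a predicate such as
  -- `appr∞` an instance of them.
  characteristic : (W → Set) → W → Bool
  characteristic A v = isYes (em {P = A v})

  characteristic⁺ : ∀ A v → A v → T (characteristic A v)
  characteristic⁺ A v = fromWitness

  characteristic⁻ : ∀ A v → T (characteristic A v) → A v
  characteristic⁻ A v = toWitness

  step : Env → Var → Fm Prop Var → (W → Set) → W → Set
  step ρ X a A = ⟦ a ⟧ (ρ [ X ↦ A ])

  -- The De Morgan dual of `step`; its stages from below are the complements of the stages from
  -- above towards the greatest fixed point.
  dualStep : Env → Var → Fm Prop Var → (W → Set) → W → Set
  dualStep ρ X a A v = ¬ step ρ X a (λ u → ¬ A u) v

  -- For the player who verifies iff b holds, a fixed point which that player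
  -- must not regenerate forever is replaced by its β-th approximant; the
  -- greatest fixed point is approximated from above.
  value : Bool → FP → Env → Var → Fm Prop Var → Ord W → W → Set
  value true  μ ρ X a β   = appr (step ρ X a) β
  value false ν ρ X a β v = ¬ appr (dualStep ρ X a) β v
  value true  ν ρ X a β   = ⟦ fix ν X a ⟧ ρ
  value false μ ρ X a β   = ⟦ fix μ X a ⟧ ρ

  module _ (ρ : Env) (X : Var) (a : Fm Prop Var) (positive : Positive X a) where

    step-mono : ∀ {A B} → A ⊆ B → step ρ X a A ⊆ step ρ X a B
    step-mono A⊆B = ⟦⟧-mono a (λ _ → update-mono A⊆B (λ _ _ x → x)) negative
      where
      negative : ∀ {Y} → FreeOcc Y a true → (ρ [ X ↦ _ ]) Y ⊆ (ρ [ X ↦ _ ]) Y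
      negative {Y} o with X ≟ Y
      ... | no _ = λ _ x → x
      ... | yes refl with () ← positive o

    dualStep-mono : ∀ {A B} → A ⊆ B → dualStep ρ X a A ⊆ dualStep ρ X a B
    dualStep-mono A⊆B v ¬x y = ¬x (step-mono (λ u ¬b a → ¬b (A⊆B u a)) v y)

    unfold-ν : ⟦ fix ν X a ⟧ ρ ⊆ step ρ X a (⟦ fix ν X a ⟧ ρ)
    unfold-ν v (A , post , x) = step-mono (λ u y → A , post , y) v (post v x)

    fold-μ : step ρ X a (⟦ fix μ X a ⟧ ρ) ⊆ ⟦ fix μ X a ⟧ ρ
    fold-μ v x A pre = pre v (step-mono (λ u f → f A pre) v x)

    -- A claim at a losing fixed point puts v into `appr∞`: for μ because that set is pre-fixed, for
    -- a refuted ν because the complement of the dual version is post-fixed.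
    enter-fix : ∀ b η v → Holds b (⟦ fix η X a ⟧ ρ v) →
                Σ[ β ∈ Ord W ] Holds b (step ρ X a (value b η ρ X a β) v)
    -- `value` ignores β at fixed points that are not losing, so `zero` is a placeholder.
    enter-fix true  ν v x  = zero , unfold-ν v x
    enter-fix false μ v ¬x = zero , ¬x ∘ fold-μ v
    enter-fix true  μ v f  = characteristic⁻ appr∞ v
      (f (characteristic appr∞) λ u x → characteristic⁺ appr∞ u
        (appr∞-prefixed u (step-mono (characteristic⁻ appr∞) u x)))
      where open Closure (step ρ X a) step-mono
    -- Refuting `step` on the complement of a stage is by definition `dualStep` on that stage, so
    -- membership in `appr∞` is already the goal.
    enter-fix false ν v ¬x = stable λ v∉ → ¬x
      ( characteristic co
      , (λ u c → step-mono (characteristic⁺ co) u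
          (stable λ ¬y → characteristic⁻ co u c (appr∞-prefixed u ¬y)))
      , characteristic⁺ co v v∉)
      where
      open Closure (dualStep ρ X a) dualStep-mono
      co : W → Set
      co u = ¬ appr∞ u

    -- Stage `zero` is empty and membership in stage `lim f` names a branch whose stage supports the
    -- unfolding, so a losing component drops strictly; the others keep β.
    regenerate : ∀ b η β v → Holds b (value b η ρ X a β v) →
                 Σ[ β′ ∈ Ord W ] (β′ ≤ₒ β × (Losing b η → β′ <ₒ β)
                   × Holds b (step ρ X a (value b η ρ X a β′) v))
    regenerate true  ν β v x  = β , ≤ₒ-refl , (λ ()) , unfold-ν v x
    regenerate false μ β v ¬x = β , ≤ₒ-refl , (λ ()) , ¬x ∘ fold-μ v
    regenerate true  μ (lim f) v (i , x) =
      f i , <ₒ⇒≤ₒ (<lim i ≤ₒ-refl) , (λ _ → <lim i ≤ₒ-refl) , x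
    regenerate false ν β v ¬¬x with β | stable ¬¬x
    ... | lim f | i , x = f i , <ₒ⇒≤ₒ (<lim i ≤ₒ-refl) , (λ _ → <lim i ≤ₒ-refl) , x

-- Binders and their scopes

data Suffix {A : Set} (k : List A) : List A → Set where
  here  : Suffix k k
  there : ∀ {x l} → Suffix k l → Suffix k (x ∷ l)

module _ {A : Set} where

  suffix-trans : ∀ {j k l : List A} → Suffix j k → Suffix k l → Suffix j l
  suffix-trans p here      = p
  suffix-trans p (there q) = there (suffix-trans p q)

  suffix-tail : ∀ {x} {k l : List A} → Suffix (x ∷ k) l → Suffix k l
  suffix-tail = suffix-trans (there here)

  suffix-[] : (l : List A) → Suffix [] l
  suffix-[] []      = here
  suffix-[] (x ∷ l) = there (suffix-[] l)

  suffix-length : ∀ {k l : List A} → Suffix k l → length k ≤ length l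
  suffix-length here      = ≤-refl
  suffix-length (there p) = m≤n⇒m≤1+n (suffix-length p)

  -- Projections of signatures take the suffix derivation as an argument; this makes two routes to
  -- the same tail give the same projection.
  suffix-irrelevant : ∀ {k l : List A} (p q : Suffix k l) → p ≡ q
  suffix-irrelevant here      here      = refl
  suffix-irrelevant here      (there q) = ⊥-elim (<-irrefl refl (suffix-length q))
  suffix-irrelevant (there p) here      = ⊥-elim (<-irrefl refl (suffix-length p))
  suffix-irrelevant (there p) (there q) = cong there (suffix-irrelevant p q)

  suffix-∈ : ∀ {B : Set} (f : A → B) {x k l} → Suffix (x ∷ k) l → f x ∈ map f l
  suffix-∈ f here      = here refl
  suffix-∈ f (there p) = there (suffix-∈ f p)

  -- A name pins down a position in the list. Equating whole triples lets one match on `refl`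
  -- identify binder, tail and derivation together.
  suffix-unique : ∀ {B : Set} (f : A → B) {l} → Unique (map f l) →
    ∀ {x y j k} (p : Suffix (x ∷ j) l) (q : Suffix (y ∷ k) l) → f x ≡ f y →
    _≡_ {A = Σ[ z ∈ A ] Σ[ i ∈ List A ] Suffix (z ∷ i) l} (x , j , p) (y , k , q)
  suffix-unique f u        here      here      eq = refl
  suffix-unique f (∉l ∷ u) here      (there q) eq = ⊥-elim (lookup ∉l (suffix-∈ f q) eq)
  suffix-unique f (∉l ∷ u) (there p) here      eq = ⊥-elim (lookup ∉l (suffix-∈ f p) (sym eq))
  suffix-unique f (∉l ∷ u) (there p) (there q) eq with suffix-unique f u p q eq
  ... | refl = refl

dual-involutive : ∀ Q → dual (dual Q) ≡ Q
dual-involutive Vᵣ = refl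
dual-involutive Rᵣ = refl

roleAt : Role → Bool → Role
roleAt Q false = Q
roleAt Q true  = dual Q

roleAt-not : ∀ Q p → roleAt Q (not p) ≡ roleAt (dual Q) p
roleAt-not Q false = refl
roleAt-not Q true  = sym (dual-involutive Q)

record Binder (Prop Var : Set) : Set where
  constructor binder
  field
    fp   : FP
    bv   : Var
    body : Fm Prop Var
    role : Role

open Binder

module _ {Prop Var : Set} where

  fixOf : Binder Prop Var → Fm Prop Var
  fixOf e = fix (fp e) (bv e) (body e)

  -- The binders of a formula with the role player I has at them, later ones in
  -- preorder first, so that the tail after a binder contains its scope.
  collect : Fm Prop Var → Role → List (Binder Prop Var) → List (Binder Prop Var)
  collect (atom P)    Q l = l
  collect (var X)     Q l = l
  collect ff          Q l = l
  collect (a ∧ᶠ b)    Q l = collect b Q (collect a Q l)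
  collect (a ∨ᶠ b)    Q l = collect b Q (collect a Q l)
  collect (a ⇒ᶠ b)    Q l = collect b Q (collect a (dual Q) l)
  collect (□ᶠ a)      Q l = collect a Q l
  collect (◇ᶠ a)      Q l = collect a Q l
  collect (fix η X a) Q l = collect a Q (binder η X a Q ∷ l)

  fix-injective-bv : ∀ {η η′ X X′} {a a′ : Fm Prop Var} → fix η X a ≡ fix η′ X′ a′ → X ≡ X′
  fix-injective-bv refl = refl

  collect-suffix : ∀ ψ Q l → Suffix l (collect ψ Q l)
  collect-suffix (atom P)    Q l = here
  collect-suffix (var X)     Q l = here
  collect-suffix ff          Q l = here
  collect-suffix (a ∧ᶠ b)    Q l = suffix-trans (collect-suffix a Q l) (collect-suffix b Q _)
  collect-suffix (a ∨ᶠ b)    Q l = suffix-trans (collect-suffix a Q l) (collect-suffix b Q _)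
  collect-suffix (a ⇒ᶠ b)    Q l =
    suffix-trans (collect-suffix a (dual Q) l) (collect-suffix b Q _)
  collect-suffix (□ᶠ a)      Q l = collect-suffix a Q l
  collect-suffix (◇ᶠ a)      Q l = collect-suffix a Q l
  collect-suffix (fix η X a) Q l = suffix-tail (collect-suffix a Q _)

  map-bv-collect : ∀ ψ Q l → map bv (collect ψ Q l) ≡ binders ψ ʳ++ map bv l
  map-bv-collect (atom P)    Q l = refl
  map-bv-collect (var X)     Q l = refl
  map-bv-collect ff          Q l = refl
  map-bv-collect (a ∧ᶠ b)    Q l = trans (map-bv-collect b Q _)
    (trans (cong (binders b ʳ++_) (map-bv-collect a Q l)) (sym (++-ʳ++ (binders a))))
  map-bv-collect (a ∨ᶠ b)    Q l = trans (map-bv-collect b Q _)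
    (trans (cong (binders b ʳ++_) (map-bv-collect a Q l)) (sym (++-ʳ++ (binders a))))
  map-bv-collect (a ⇒ᶠ b)    Q l = trans (map-bv-collect b Q _)
    (trans (cong (binders b ʳ++_) (map-bv-collect a (dual Q) l)) (sym (++-ʳ++ (binders a))))
  map-bv-collect (□ᶠ a)      Q l = map-bv-collect a Q l
  map-bv-collect (◇ᶠ a)      Q l = map-bv-collect a Q l
  map-bv-collect (fix η X a) Q l = map-bv-collect a Q _

  collect-unique : ∀ ψ Q → Unique (binders ψ) → Unique (map bv (collect ψ Q []))
  collect-unique ψ Q u = subst Unique (sym (map-bv-collect ψ Q []))
    (Unique-resp-↭ (setoid Var) (↭⇒↭ₛ (↭-sym (↭-reverse (binders ψ)))) u)

  -- The second suffix puts everything collected before ψ into the tail of the binder found; hence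
  -- the components of `l` survive when that nested fixed point is entered.
  collected : ∀ {ψ η Y b} Q l → fix η Y b ⊑ ψ →
    Σ[ Q′ ∈ Role ] Σ[ k ∈ List (Binder Prop Var) ]
      (Suffix (binder η Y b Q′ ∷ k) (collect ψ Q l) × Suffix l k)
  collected {fix _ _ a} Q l here     = Q , l , collect-suffix a Q _ , here
  collected {a ∧ᶠ b}    Q l (∧l s)   with collected Q l s
  ... | Q′ , k , p , q = Q′ , k , suffix-trans p (collect-suffix b Q _) , q
  collected {a ∨ᶠ b}    Q l (∨l s)   with collected Q l s
  ... | Q′ , k , p , q = Q′ , k , suffix-trans p (collect-suffix b Q _) , q
  collected {a ⇒ᶠ b}    Q l (⇒l s)   with collected (dual Q) l s
  ... | Q′ , k , p , q = Q′ , k , suffix-trans p (collect-suffix b Q _) , q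
  collected {a ∧ᶠ b}    Q l (∧r s)   with collected Q (collect a Q l) s
  ... | Q′ , k , p , q = Q′ , k , p , suffix-trans (collect-suffix a Q l) q
  collected {a ∨ᶠ b}    Q l (∨r s)   with collected Q (collect a Q l) s
  ... | Q′ , k , p , q = Q′ , k , p , suffix-trans (collect-suffix a Q l) q
  collected {a ⇒ᶠ b}    Q l (⇒r s)   with collected Q (collect a (dual Q) l) s
  ... | Q′ , k , p , q = Q′ , k , p , suffix-trans (collect-suffix a (dual Q) l) q
  collected {□ᶠ a}      Q l (□s s)   = collected Q l s
  collected {◇ᶠ a}      Q l (◇s s)   = collected Q l s
  collected {fix η X a} Q l (fixs s) with collected Q (binder η X a Q ∷ l) s
  ... | Q′ , k , p , q = Q′ , k , p , suffix-tail q

  -- The last equation is the invariant tying parity to roles: descending to an occurrence of parity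
  -- `p` changes Q into `roleAt Q p`, which has to be the role of its binder.
  Scoped : List (Binder Prop Var) → Fm Prop Var → Role → Set
  Scoped l ψ Q = ∀ {X p} → FreeOcc X ψ p →
    Σ[ e ∈ Binder Prop Var ] Σ[ k ∈ List (Binder Prop Var) ]
      (Suffix (e ∷ k) l × bv e ≡ X × role e ≡ roleAt Q p)

  weaken : ∀ {l m ψ Q} → Suffix l m → Scoped l ψ Q → Scoped m ψ Q
  weaken s sc o with sc o
  ... | e , k , p , eq = e , k , suffix-trans p s , eq

  ⊑-trans : ∀ {a b c : Fm Prop Var} → a ⊑ b → b ⊑ c → a ⊑ c
  ⊑-trans p here     = p
  ⊑-trans p (∧l q)   = ∧l (⊑-trans p q)
  ⊑-trans p (∧r q)   = ∧r (⊑-trans p q)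
  ⊑-trans p (∨l q)   = ∨l (⊑-trans p q)
  ⊑-trans p (∨r q)   = ∨r (⊑-trans p q)
  ⊑-trans p (⇒l q)   = ⇒l (⊑-trans p q)
  ⊑-trans p (⇒r q)   = ⇒r (⊑-trans p q)
  ⊑-trans p (□s q)   = □s (⊑-trans p q)
  ⊑-trans p (◇s q)   = ◇s (⊑-trans p q)
  ⊑-trans p (fixs q) = fixs (⊑-trans p q)

  -- Arrows and diamonds count twice because of the auxiliary game positions.
  size : Fm Prop Var → ℕ
  size (atom P)    = 1
  size (var X)     = 1
  size ff          = 1
  size (a ∧ᶠ b)    = suc (size a + size b)
  size (a ∨ᶠ b)    = suc (size a + size b)
  size (a ⇒ᶠ b)    = suc (suc (size a + size b))
  size (□ᶠ a)      = suc (size a)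
  size (◇ᶠ a)      = suc (suc (size a))
  size (fix η X a) = suc (size a)

  size-mono : ∀ {a b : Fm Prop Var} → a ⊑ b → size a ≤ size b
  size-mono here     = ≤-refl
  size-mono (∧l p)   = m≤n⇒m≤1+n (≤-trans (size-mono p) (m≤m+n _ _))
  size-mono (∧r p)   = m≤n⇒m≤1+n (≤-trans (size-mono p) (m≤n+m _ _))
  size-mono (∨l p)   = m≤n⇒m≤1+n (≤-trans (size-mono p) (m≤m+n _ _))
  size-mono (∨r p)   = m≤n⇒m≤1+n (≤-trans (size-mono p) (m≤n+m _ _))
  size-mono (⇒l p)   = m≤n⇒m≤1+n (m≤n⇒m≤1+n (≤-trans (size-mono p) (m≤m+n _ _)))
  size-mono (⇒r p)   = m≤n⇒m≤1+n (m≤n⇒m≤1+n (≤-trans (size-mono p) (m≤n+m _ _)))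
  size-mono (□s p)   = m≤n⇒m≤1+n (size-mono p)
  size-mono (◇s p)   = m≤n⇒m≤1+n (m≤n⇒m≤1+n (size-mono p))
  size-mono (fixs p) = m≤n⇒m≤1+n (size-mono p)

  ⊑-antisym : ∀ {a b : Fm Prop Var} → a ⊑ b → b ⊑ a → a ≡ b
  ⊑-antisym {a} {b} p q = cases p (size-mono q)
    where
    too-large : ∀ {c m} → a ⊑ c → size c ≤ m → suc m ≤ size a → a ≡ b
    too-large p c≤m m<a = ⊥-elim (<-irrefl refl (≤-trans (s≤s (≤-trans (size-mono p) c≤m)) m<a))

    cases : a ⊑ b → size b ≤ size a → a ≡ b
    cases here     le = refl
    cases (∧l p)   le = too-large p (m≤m+n _ _) le
    cases (∧r p)   le = too-large p (m≤n+m _ _) le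
    cases (∨l p)   le = too-large p (m≤m+n _ _) le
    cases (∨r p)   le = too-large p (m≤n+m _ _) le
    cases (⇒l p)   le = too-large p (m≤n⇒m≤1+n (m≤m+n _ _)) le
    cases (⇒r p)   le = too-large p (m≤n⇒m≤1+n (m≤n+m _ _)) le
    cases (□s p)   le = too-large p ≤-refl le
    cases (◇s p)   le = too-large p (n≤1+n _) le
    cases (fixs p) le = too-large p ≤-refl le

  -- Used for a play inside a fixed point ψ: regenerating a variable bound in ψ stays inside, while
  -- a free one leads to a binder outside.
  free-or-bound : DecidableEquality Var → ∀ {X ψ} → var X ⊑ ψ →
    Σ[ p ∈ Bool ] FreeOcc X ψ p ⊎ Σ[ η ∈ FP ] Σ[ a ∈ Fm Prop Var ] fix η X a ⊑ ψ
  free-or-bound _≟_ here     = inj₁ (false , here)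
  free-or-bound _≟_ (∧l s) with free-or-bound _≟_ s
  ... | inj₁ (p , o)     = inj₁ (p , ∧l o)
  ... | inj₂ (η , a , t) = inj₂ (η , a , ∧l t)
  free-or-bound _≟_ (∧r s) with free-or-bound _≟_ s
  ... | inj₁ (p , o)     = inj₁ (p , ∧r o)
  ... | inj₂ (η , a , t) = inj₂ (η , a , ∧r t)
  free-or-bound _≟_ (∨l s) with free-or-bound _≟_ s
  ... | inj₁ (p , o)     = inj₁ (p , ∨l o)
  ... | inj₂ (η , a , t) = inj₂ (η , a , ∨l t)
  free-or-bound _≟_ (∨r s) with free-or-bound _≟_ s
  ... | inj₁ (p , o)     = inj₁ (p , ∨r o)
  ... | inj₂ (η , a , t) = inj₂ (η , a , ∨r t)
  free-or-bound _≟_ (⇒l s) with free-or-bound _≟_ s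
  ... | inj₁ (p , o)     = inj₁ (not p , ⇒l o)
  ... | inj₂ (η , a , t) = inj₂ (η , a , ⇒l t)
  free-or-bound _≟_ (⇒r s) with free-or-bound _≟_ s
  ... | inj₁ (p , o)     = inj₁ (p , ⇒r o)
  ... | inj₂ (η , a , t) = inj₂ (η , a , ⇒r t)
  free-or-bound _≟_ (□s s) with free-or-bound _≟_ s
  ... | inj₁ (p , o)     = inj₁ (p , □s o)
  ... | inj₂ (η , a , t) = inj₂ (η , a , □s t)
  free-or-bound _≟_ (◇s s) with free-or-bound _≟_ s
  ... | inj₁ (p , o)     = inj₁ (p , ◇s o)
  ... | inj₂ (η , a , t) = inj₂ (η , a , ◇s t)
  free-or-bound _≟_ {X} (fixs {η = η} {X = Y} {a = b} s) with free-or-bound _≟_ s | Y ≟ X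
  ... | inj₂ (η′ , a , t) | _        = inj₂ (η′ , a , fixs t)
  ... | inj₁ (p , o)      | no Y≢X   = inj₁ (p , fixs Y≢X o)
  ... | inj₁ (p , o)      | yes refl = inj₂ (η , b , here)

-- Occurrences of subformulas and their scopes

module Scoping {Prop Var : Set} (_≟_ : DecidableEquality Var) (φ : Fm Prop Var) (muFormula : MuFormula φ)
  (sentence : Sentence φ) (unique : Unique (binders φ)) where

  L : List (Binder Prop Var)
  L = collect φ Vᵣ []

  L-unique : ∀ {e f j k} (p : Suffix (e ∷ j) L) (q : Suffix (f ∷ k) L) → bv e ≡ bv f →
    _≡_ {A = Σ[ g ∈ Binder Prop Var ] Σ[ i ∈ List (Binder Prop Var) ] Suffix (g ∷ i) L}
      (e , j , p) (f , k , q)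
  L-unique = suffix-unique bv (collect-unique φ Vᵣ unique)

  -- Locates an occurrence of ψ: `l` is the accumulator with which `collect` arrives there. The
  -- relation `ψ ⊑ φ` alone would not fix it, as equal subformulas may occur at several places and
  -- with different roles.
  record InScope (l : List (Binder Prop Var)) (ψ : Fm Prop Var) (Q : Role) : Set where
    constructor inScope
    field
      sub    : ψ ⊑ φ
      suffix : Suffix (collect ψ Q l) L
      scoped : Scoped l ψ Q

  inScope-φ : InScope [] φ Vᵣ
  inScope-φ = inScope here here λ o → ⊥-elim (sentence _ _ o)

  inScope-∧l : ∀ {l a b Q} → InScope l (a ∧ᶠ b) Q → InScope l a Q
  inScope-∧l {b = b} (inScope s p sc) =
    inScope (⊑-trans (∧l here) s) (suffix-trans (collect-suffix b _ _) p) (sc ∘ ∧l)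

  inScope-∧r : ∀ {l a b Q} → InScope l (a ∧ᶠ b) Q → InScope (collect a Q l) b Q
  inScope-∧r {a = a} (inScope s p sc) =
    inScope (⊑-trans (∧r here) s) p (weaken (collect-suffix a _ _) (sc ∘ ∧r))

  inScope-∨l : ∀ {l a b Q} → InScope l (a ∨ᶠ b) Q → InScope l a Q
  inScope-∨l {b = b} (inScope s p sc) =
    inScope (⊑-trans (∨l here) s) (suffix-trans (collect-suffix b _ _) p) (sc ∘ ∨l)

  inScope-∨r : ∀ {l a b Q} → InScope l (a ∨ᶠ b) Q → InScope (collect a Q l) b Q
  inScope-∨r {a = a} (inScope s p sc) =
    inScope (⊑-trans (∨r here) s) p (weaken (collect-suffix a _ _) (sc ∘ ∨r))

  inScope-⇒l : ∀ {l a b Q} → InScope l (a ⇒ᶠ b) Q → InScope l a (dual Q)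
  inScope-⇒l {l} {a} {b} {Q} (inScope s p sc) =
    inScope (⊑-trans (⇒l here) s) (suffix-trans (collect-suffix b _ _) p) flipped
    where
    flipped : Scoped l a (dual Q)
    flipped {p = p} o with sc (⇒l o)
    ... | e , k , q , eq , r = e , k , q , eq , trans r (roleAt-not Q p)

  inScope-⇒r : ∀ {l a b Q} → InScope l (a ⇒ᶠ b) Q → InScope (collect a (dual Q) l) b Q
  inScope-⇒r {a = a} (inScope s p sc) =
    inScope (⊑-trans (⇒r here) s) p (weaken (collect-suffix a _ _) (sc ∘ ⇒r))

  inScope-□ : ∀ {l a Q} → InScope l (□ᶠ a) Q → InScope l a Q
  inScope-□ (inScope s p sc) = inScope (⊑-trans (□s here) s) p (sc ∘ □s)

  inScope-◇ : ∀ {l a Q} → InScope l (◇ᶠ a) Q → InScope l a Q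
  inScope-◇ (inScope s p sc) = inScope (⊑-trans (◇s here) s) p (sc ∘ ◇s)

  inScope-fix : ∀ {l η X a Q} → InScope l (fix η X a) Q → InScope (binder η X a Q ∷ l) a Q
  inScope-fix {l} {η} {X} {a} {Q} (inScope s p sc) = inScope (⊑-trans (fixs here) s) p body-scoped
    where
    body-scoped : Scoped (binder η X a Q ∷ l) a Q
    body-scoped {Y} o with X ≟ Y
    ... | no X≢Y with sc (fixs X≢Y o)
    ...   | e , k , q , eq = e , k , there q , eq
    -- Positivity makes the parity even, so the occurrence is met with the binder's own role.
    body-scoped {Y} o | yes refl with muFormula s o
    ...   | refl = _ , _ , here , refl , refl

  collected-inScope : ∀ ψ {Q l e k} → InScope l ψ Q → Suffix (e ∷ k) (collect ψ Q l) →
                      Suffix (e ∷ k) l ⊎ InScope k (fixOf e) (role e)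
  collected-inScope (atom P) i p = inj₁ p
  collected-inScope (var X)  i p = inj₁ p
  collected-inScope ff       i p = inj₁ p
  collected-inScope (a ∧ᶠ b) i p with collected-inScope b (inScope-∧r i) p
  ... | inj₁ q = collected-inScope a (inScope-∧l i) q
  ... | inj₂ j = inj₂ j
  collected-inScope (a ∨ᶠ b) i p with collected-inScope b (inScope-∨r i) p
  ... | inj₁ q = collected-inScope a (inScope-∨l i) q
  ... | inj₂ j = inj₂ j
  collected-inScope (a ⇒ᶠ b) i p with collected-inScope b (inScope-⇒r i) p
  ... | inj₁ q = collected-inScope a (inScope-⇒l i) q
  ... | inj₂ j = inj₂ j
  collected-inScope (□ᶠ a) i p = collected-inScope a (inScope-□ i) p
  collected-inScope (◇ᶠ a) i p = collected-inScope a (inScope-◇ i) p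
  collected-inScope (fix η X a) i p with collected-inScope a (inScope-fix i) p
  ... | inj₁ here      = inj₂ i
  ... | inj₁ (there q) = inj₁ q
  ... | inj₂ j         = inj₂ j

  -- Regeneration jumps from a variable to its binder, whose scope is an earlier one; the position
  -- in `L` is enough to recover it.
  binder-inScope : ∀ {e k} → Suffix (e ∷ k) L → InScope k (fixOf e) (role e)
  binder-inScope p with collected-inScope φ inScope-φ p
  ... | inj₂ i = i

-- Signatures and truth of positions

verifies : Player → Role → Bool
verifies I  Vᵣ = true
verifies I  Rᵣ = false
verifies II Vᵣ = false
verifies II Rᵣ = true

isVerifier : Role → Bool
isVerifier Vᵣ = true
isVerifier Rᵣ = false

self-or-other : ∀ pl pl′ → pl′ ≡ pl ⊎ pl′ ≡ other pl
self-or-other I  I  = inj₁ refl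
self-or-other I  II = inj₂ refl
self-or-other II I  = inj₂ refl
self-or-other II II = inj₁ refl

verifies-dual : ∀ pl Q → verifies pl (dual Q) ≡ not (verifies pl Q)
verifies-dual I  Vᵣ = refl
verifies-dual I  Rᵣ = refl
verifies-dual II Vᵣ = refl
verifies-dual II Rᵣ = refl

verifies-owner : ∀ {pl} Q r → holder Q r ≡ pl → verifies pl Q ≡ isVerifier r
verifies-owner Vᵣ Vᵣ refl = refl
verifies-owner Vᵣ Rᵣ refl = refl
verifies-owner Rᵣ Vᵣ refl = refl
verifies-owner Rᵣ Rᵣ refl = refl

verifies-opponent : ∀ {pl} Q r → holder Q r ≡ other pl → verifies pl Q ≡ not (isVerifier r)
verifies-opponent {I}  Vᵣ Rᵣ _ = refl
verifies-opponent {I}  Rᵣ Vᵣ _ = refl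
verifies-opponent {II} Vᵣ Vᵣ _ = refl
verifies-opponent {II} Rᵣ Rᵣ _ = refl

module Signatures (em : ExcludedMiddle 0ℓ) {Prop Var : Set}
  (_≟_ : DecidableEquality Var) (M : CKModel Prop) (pl : Player) where

  open Classical em
  open CKModel M
  open Semantics _≟_ M
  open Denotation em _≟_ M

  order : List (Binder Prop Var) → WellPreorder
  order []      = unitOrder
  order (e ∷ l) = lexOrder (ordOrder W) (order l)

  module Order (l : List (Binder Prop Var)) = WellPreorder (order l)

  Sig : List (Binder Prop Var) → Set
  Sig l = Order.Carrier l

  restrict : ∀ {k l} → Suffix k l → Sig l → Sig k
  restrict here      s       = s
  restrict (there p) (_ , s) = restrict p s

  -- This is the reset of later components. A formula scoped in `k` does not mention their
  -- variables, so its truth is unaffected.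
  extend : ∀ {k l} → Suffix k l → Sig k → Sig l
  extend here      s = s
  extend (there p) s = zero , extend p s

  restrict-extend : ∀ {k l} (p : Suffix k l) s → restrict p (extend p s) ≡ s
  restrict-extend here      s = refl
  restrict-extend (there p) s = restrict-extend p s

  restrict-trans : ∀ {j k l} (p : Suffix j k) (q : Suffix k l) s →
                   restrict (suffix-trans p q) s ≡ restrict p (restrict q s)
  restrict-trans p here      s       = refl
  restrict-trans p (there q) (_ , s) = restrict-trans p q s

  -- A suffix keeps the most significant components, which the lexicographic order compares before
  -- the rest.
  restrict-mono : ∀ {k l} (p : Suffix k l) {s t} → Order._≼_ l s t →
                  Order._≼_ k (restrict p s) (restrict p t)
  restrict-mono here s≼t = s≼t
  restrict-mono {l = _ ∷ l} (there p) (inj₁ s≺t)       = restrict-mono p (Order.≺⇒≼ l s≺t)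
  restrict-mono             (there p) (inj₂ (s≼t , _)) = restrict-mono p s≼t

  env : ∀ l → Sig l → Env
  env []      _       = emptyEnv
  env (e ∷ l) (β , s) =
    env l s [ bv e ↦ value (verifies pl (role e)) (fp e) (env l s) (bv e) (body e) β ]

  env-restrict : ∀ {l} → Unique (map bv l) → ∀ {k} (p : Suffix k l) s {e j} →
                 Suffix (e ∷ j) k → env l s (bv e) ≡ env k (restrict p s) (bv e)
  env-restrict             u        here      s       q = refl
  env-restrict {l = _ ∷ l} (∉l ∷ u) (there p) (_ , s) q = trans
    (update-other (env l s) _ (lookup ∉l (suffix-∈ bv (suffix-trans q p))))
    (env-restrict u p s q)

-- Positions of the game, their owners and weights

module Arena {Prop Var : Set} (_≟_ : DecidableEquality Var)
  (M : CKModel Prop) (w : CKModel.W M) (φ : Fm Prop Var) (muFormula : MuFormula φ)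
  (sentence : Sentence φ) (unique : Unique (binders φ)) where

  open CKModel M
  open Scoping _≟_ φ muFormula sentence unique
  open Game M φ w

  formula : Pos → Fm Prop Var
  formula = λ where
    (pos v ψ Q)    → ψ
    (dpos v a Q)   → ◇ᶠ a
    (ipos v a b Q) → a ⇒ᶠ b

  weight : Pos → ℕ
  weight = λ where
    (pos v ψ Q)    → size ψ
    (dpos v a Q)   → suc (size a)
    (ipos v a b Q) → suc (size a + size b)

  Occurs : Pos → Set
  Occurs p = Σ[ l ∈ _ ] InScope l (formula p) (roleI p)

  -- Scoping supplies a binder of X with the right role, `collected` one with the right body; unique
  -- names make them the same.
  binder-at : ∀ {l X Q η a} → InScope l (var X) Q → fix η X a ⊑ φ →
              Σ[ k ∈ _ ] Suffix (binder η X a Q ∷ k) L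
  binder-at (inScope _ p sc) s with sc here | collected Vᵣ [] s
  ... | e , k , q , refl , refl | Q′ , k′ , q′ , _ with L-unique (suffix-trans q p) q′ refl
  ... | refl = k , q′

  binder-of : ∀ {l η X a Q} → InScope l (fix η X a) Q → Suffix (binder η X a Q ∷ l) L
  binder-of {a = a} (inScope _ p _) = suffix-trans (collect-suffix a _ _) p

  weight-fix : ∀ q {η X a} → formula q ≡ fix η X a → weight q ≡ size (formula q)
  weight-fix (pos _ _ _) _ = refl

  binder-of-⊑ : ∀ {η X a} → fix η X a ⊑ φ → Σ[ Q ∈ Role ] Σ[ k ∈ _ ] Suffix (binder η X a Q ∷ k) L
  binder-of-⊑ s with collected Vᵣ [] s
  ... | Q , k , p , _ = Q , k , p

  occurs-start : Occurs start
  occurs-start = [] , inScope-φ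

  occurs-move : ∀ {p q} → Occurs p → Move p q → Occurs q
  occurs-move (_ , i) ∨l        = _ , inScope-∨l i
  occurs-move (_ , i) ∨r        = _ , inScope-∨r i
  occurs-move (_ , i) ?l        = _ , inScope-⇒l i
  occurs-move (_ , i) ?r        = _ , inScope-⇒r i
  occurs-move (_ , i) (◇̂m _)    = _ , inScope-◇ i
  occurs-move (_ , i) unfold    = _ , inScope-fix i
  occurs-move (_ , i) (regen s) = _ , binder-inScope (proj₂ (binder-at i s))
  occurs-move (_ , i) ∧l        = _ , inScope-∧l i
  occurs-move (_ , i) ∧r        = _ , inScope-∧r i
  occurs-move (l , i) (⇒m _)    = l , i
  occurs-move (_ , i) (□m _ _)  = _ , inScope-□ i
  occurs-move (l , i) (◇m _)    = l , i

  occurs-reach : ∀ {p} → Reach p → Occurs p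
  occurs-reach reach0     = occurs-start
  occurs-reach (step r m) = occurs-move (occurs-reach r) m

  occurs-inGame : ∀ p → Occurs p → InGame p
  occurs-inGame (pos _ _ _)    (_ , i) = pos (InScope.sub i)
  occurs-inGame (dpos _ _ _)   (_ , i) = dpos (InScope.sub i)
  occurs-inGame (ipos _ _ _ _) (_ , i) = ipos (InScope.sub i)

  fix-unique : ∀ {η η′ X a a′} → fix η X a ⊑ φ → fix η′ X a′ ⊑ φ → fix η X a ≡ fix η′ X a′
  fix-unique s t with binder-of-⊑ s | binder-of-⊑ t
  ... | _ , _ , p | _ , _ , q with L-unique p q refl
  ... | refl = refl

  -- All visits to a fixed-point formula happen with one role, so a single reachable visit decides
  -- who owns it.
  inScope-role : ∀ {e j k Q} → Suffix (e ∷ k) L → InScope j (fixOf e) Q → role e ≡ Q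
  inScope-role p i with L-unique p (binder-of i) refl
  ... | refl = refl

  RoleOf-unique : ∀ {p r r′} → RoleOf p r → RoleOf p r′ → r ≡ r′
  RoleOf-unique (atomV ∉) (atomR ∈) = ⊥-elim (∉ ∈)
  RoleOf-unique (atomR ∈) (atomV ∉) = ⊥-elim (∉ ∈)
  RoleOf-unique (ffV ∉)   (ffR ∈)   = ⊥-elim (∉ ∈)
  RoleOf-unique (ffR ∈)   (ffV ∉)   = ⊥-elim (∉ ∈)
  RoleOf-unique (varμ s)  (varν t) with () ← fix-unique s t
  RoleOf-unique (varν s)  (varμ t) with () ← fix-unique s t
  RoleOf-unique (atomV _) (atomV _) = refl
  RoleOf-unique (atomR _) (atomR _) = refl
  RoleOf-unique (ffV _)   (ffV _)   = refl
  RoleOf-unique (ffR _)   (ffR _)   = refl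
  RoleOf-unique (varμ _)  (varμ _)  = refl
  RoleOf-unique (varν _)  (varν _)  = refl
  RoleOf-unique ∨V ∨V = refl
  RoleOf-unique ?V ?V = refl
  RoleOf-unique ◇̂V ◇̂V = refl
  RoleOf-unique μV μV = refl
  RoleOf-unique ∧R ∧R = refl
  RoleOf-unique ⇒R ⇒R = refl
  RoleOf-unique □R □R = refl
  RoleOf-unique ◇R ◇R = refl
  RoleOf-unique νR νR = refl

  role-exists : ExcludedMiddle 0ℓ → ∀ p → Occurs p → Σ[ r ∈ Role ] RoleOf p r
  role-exists em (pos v (atom P) Q) o with em {P = V P v}
  ... | yes ∈V = _ , atomR ∈V
  ... | no ∉V  = _ , atomV ∉V
  role-exists em (pos v ff Q) o with em {P = W⊥ v}
  ... | yes ∈W⊥ = _ , ffR ∈W⊥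
  ... | no ∉W⊥  = _ , ffV ∉W⊥
  role-exists em (pos v (var X) Q) (_ , inScope _ p sc) with sc here
  ... | binder μ _ _ _ , _ , q , refl , _ =
    _ , varμ (InScope.sub (binder-inScope (suffix-trans q p)))
  ... | binder ν _ _ _ , _ , q , refl , _ =
    _ , varν (InScope.sub (binder-inScope (suffix-trans q p)))
  role-exists em (pos v (a ∧ᶠ b) Q)    o = _ , ∧R
  role-exists em (pos v (a ∨ᶠ b) Q)    o = _ , ∨V
  role-exists em (pos v (a ⇒ᶠ b) Q)    o = _ , ⇒R
  role-exists em (pos v (□ᶠ a) Q)      o = _ , □R
  role-exists em (pos v (◇ᶠ a) Q)      o = _ , ◇R
  role-exists em (pos v (fix μ X a) Q) o = _ , μV
  role-exists em (pos v (fix ν X a) Q) o = _ , νR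
  role-exists em (dpos v a Q)          o = _ , ◇̂V
  role-exists em (ipos v a b Q)        o = _ , ?V

  owner-exists : ExcludedMiddle 0ℓ → ∀ pl p → Occurs p → Owns pl p ⊎ Owns (other pl) p
  owner-exists em pl p o = assign (role-exists em p o)
    where
    assign : Σ[ r ∈ Role ] RoleOf p r → Owns pl p ⊎ Owns (other pl) p
    assign (r , x) = Sum.map (λ eq → r , x , eq) (λ eq → r , x , eq) (self-or-other pl _)

  owner-unique : ∀ {p} → Owns I p → Owns II p → ⊥
  owner-unique (r , x , eq) (r′ , y , eq′) with RoleOf-unique x y
  ... | refl with () ← trans (sym eq) eq′

  Descends Regenerates : Pos → Pos → Set
  Descends p q = formula q ⊑ formula p × weight q < weight p
  Regenerates p q = Σ[ v ∈ W ] Σ[ X ∈ Var ] Σ[ Q ∈ Role ] Σ[ η ∈ FP ] Σ[ a ∈ Fm Prop Var ]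
    (fix η X a ⊑ φ × p ≡ pos v (var X) Q × q ≡ pos v (fix η X a) Q)

  classify : ∀ {p q} → Move p q → Descends p q ⊎ Regenerates p q
  classify ∨l        = inj₁ (∨l here , s≤s (m≤m+n _ _))
  classify ∨r        = inj₁ (∨r here , s≤s (m≤n+m _ _))
  classify ?l        = inj₁ (⇒l here , s≤s (m≤m+n _ _))
  classify ?r        = inj₁ (⇒r here , s≤s (m≤n+m _ _))
  classify (◇̂m _)    = inj₁ (◇s here , ≤-refl)
  classify unfold    = inj₁ (fixs here , ≤-refl)
  classify (regen s) = inj₂ (_ , _ , _ , _ , _ , s , refl , refl)
  classify ∧l        = inj₁ (∧l here , s≤s (m≤m+n _ _))
  classify ∧r        = inj₁ (∧r here , s≤s (m≤n+m _ _))
  classify (⇒m _)    = inj₁ (here , ≤-refl)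
  classify (□m _ _)  = inj₁ (□s here , ≤-refl)
  classify (◇m _)    = inj₁ (here , ≤-refl)

  weight≤size : ∀ p → weight p ≤ size (formula p)
  weight≤size (pos _ _ _)    = ≤-refl
  weight≤size (dpos _ _ _)   = n≤1+n _
  weight≤size (ipos _ _ _ _) = n≤1+n _

-- Truth and signatures along single moves

module Truth (em : ExcludedMiddle 0ℓ) {Prop Var : Set} (_≟_ : DecidableEquality Var)
  (M : CKModel Prop) (w : CKModel.W M) (φ : Fm Prop Var) (muFormula : MuFormula φ)
  (sentence : Sentence φ) (unique : Unique (binders φ)) (pl : Player) where

  open Classical em
  open CKModel M
  open Semantics _≟_ M
  open Denotation em _≟_ M
  open Scoping _≟_ φ muFormula sentence unique
  open Signatures em _≟_ M pl
  open Game M φ w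
  open Arena _≟_ M w φ muFormula sentence unique

  relocate : ∀ {k ψ Q} (p : Suffix k L) → Scoped k ψ Q → ∀ s b {v} →
             Holds b (⟦ ψ ⟧ (env L s) v) → Holds b (⟦ ψ ⟧ (env k (restrict p s)) v)
  relocate {k} {ψ} p sc s b = ⟦⟧-cong b ψ eq
    where
    eq : ∀ {X q} → FreeOcc X ψ q → env L s X ≡ env k (restrict p s) X
    eq o with sc o
    ... | e , j , q , refl , _ = env-restrict {L} (collect-unique φ Vᵣ unique) p s q

  unrelocate : ∀ {k ψ Q} (p : Suffix k L) → Scoped k ψ Q → ∀ s b {v} →
               Holds b (⟦ ψ ⟧ (env k s) v) → Holds b (⟦ ψ ⟧ (env L (extend p s)) v)
  unrelocate {k} {ψ} p sc s b = ⟦⟧-cong b ψ eq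
    where
    eq : ∀ {X q} → FreeOcc X ψ q → env k s X ≡ env L (extend p s) X
    eq {X} o with sc o
    ... | e , j , q , refl , _ = sym (trans
      (env-restrict {L} (collect-unique φ Vᵣ unique) p (extend p s) q)
      (cong (λ t → env k t X) (restrict-extend p s)))

  unfolded : Fm Prop Var → Fm Prop Var
  unfolded (fix η X a) = a
  unfolded (atom P)    = atom P
  unfolded (var X)     = var X
  unfolded ff          = ff
  unfolded (a ∧ᶠ b)    = a ∧ᶠ b
  unfolded (a ∨ᶠ b)    = a ∨ᶠ b
  unfolded (a ⇒ᶠ b)    = a ⇒ᶠ b
  unfolded (□ᶠ a)      = □ᶠ a
  unfolded (◇ᶠ a)      = ◇ᶠ a

  -- At a fixed point the signature already bounds its first regeneration, so
  -- that unfolding it does not change the signature.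
  Claim : Sig L → Pos → Set
  Claim s (pos v ψ Q)    = ⟦ unfolded ψ ⟧ (env L s) v
  Claim s (dpos v a Q)   = Σ[ u ∈ W ] (R v u × ⟦ a ⟧ (env L s) u)
  Claim s (ipos v a b Q) = ⟦ a ⟧ (env L s) v → ⟦ b ⟧ (env L s) v

  True : Sig L → Pos → Set
  True s p = Holds (verifies pl (roleI p)) (Claim s p)

  -- The weight condition of keep and enter rules out that the move from p to q
  -- regenerates a variable.
  data Change (p q : Pos) (s s′ : Sig L) : Set where
    keep  : weight q < weight p → s′ ≡ s → Change p q s s′
    enter : ∀ {e l} → weight q < weight p → formula q ≡ fixOf e → (i : Suffix (e ∷ l) L) →
            Order._≼_ l (restrict (suffix-tail i) s′) (restrict (suffix-tail i) s) →
            Change p q s s′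
    regen : ∀ {e l} → formula q ≡ fixOf e → (i : Suffix (e ∷ l) L) →
            Order._≼_ (e ∷ l) (restrict i s′) (restrict i s) →
            (Losing (verifies pl (role e)) (fp e) →
             Order._≺_ (e ∷ l) (restrict i s′) (restrict i s)) →
            Change p q s s′

  Next : Pos → Pos → Sig L → Set
  Next p q s = Σ[ s′ ∈ Sig L ] (True s′ q × Change p q s s′)

  -- The claim at a fixed point concerns its body, so a stage is chosen on arrival. That component
  -- may grow and later ones return to zero; only the earlier ones are kept.
  arrive : ∀ {p v l Q} ψ s → InScope l ψ Q → size ψ < weight p →
           Holds (verifies pl Q) (⟦ ψ ⟧ (env L s) v) → Next p (pos v ψ Q) s
  arrive {p} {v} {l} {Q} (fix η X a) s i lt x = s′ , true′ , enter lt refl suf (subst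
      (λ t → Order._≼_ l t (restrict (suffix-tail suf) s)) (sym restricted) (Order.≼-refl l))
    where
    open InScope i
    b = verifies pl Q
    suf = binder-of i
    r = restrict (suffix-tail suf) s
    entered = enter-fix (env l r) X a (muFormula sub) b η v (relocate (suffix-tail suf) scoped s b x)
    s′ = extend suf (proj₁ entered , r)
    true′ : True s′ (pos v (fix η X a) Q)
    true′ = unrelocate suf (InScope.scoped (inScope-fix i)) _ b (proj₂ entered)
    restricted : restrict (suffix-tail suf) s′ ≡ r
    restricted = trans (restrict-trans (there here) suf s′)
      (cong (restrict {l} {binder η X a Q ∷ l} (there here)) (restrict-extend suf (proj₁ entered , r)))
  arrive (atom P) s i lt x = s , x , keep lt refl
  arrive (var X)  s i lt x = s , x , keep lt refl
  arrive ff       s i lt x = s , x , keep lt refl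
  arrive (a ∧ᶠ b) s i lt x = s , x , keep lt refl
  arrive (a ∨ᶠ b) s i lt x = s , x , keep lt refl
  arrive (a ⇒ᶠ b) s i lt x = s , x , keep lt refl
  arrive (□ᶠ a)   s i lt x = s , x , keep lt refl
  arrive (◇ᶠ a)   s i lt x = s , x , keep lt refl

  -- The environment gives X the stage β of its binder, formed under the components of earlier
  -- binders. Those stay, β makes room for the stage from `regenerate`, and later components return
  -- to zero.
  regenerated : ∀ {v l η X a Q} s → InScope l (var X) Q → fix η X a ⊑ φ →
                True s (pos v (var X) Q) → Next (pos v (var X) Q) (pos v (fix η X a) Q) s
  regenerated {v} {η = η} {X} {a} {Q} s i sub x = s′ , true′ , regen refl suf
      (subst (λ t → Order._≼_ (e ∷ k) t (restrict suf s)) (sym (restrict-extend suf _))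
        (inj₂ (Order.≼-refl k , proj₁ (proj₂ new))))
      (λ losing → subst (λ t → Order._≺_ (e ∷ k) t (restrict suf s)) (sym (restrict-extend suf _))
        (inj₂ (Order.≼-refl k , proj₁ (proj₂ (proj₂ new)) losing)))
    where
    b = verifies pl Q
    e = binder η X a Q
    k = proj₁ (binder-at i sub)
    suf = proj₂ (binder-at i sub)
    β = proj₁ (restrict suf s)
    r = proj₂ (restrict suf s)
    value-holds : Holds b (value b η (env k r) X a β v)
    value-holds = subst (λ A → Holds b (A v))
      (trans (env-restrict {L} (collect-unique φ Vᵣ unique) suf s here) (update-same (env k r) X _)) x
    new = regenerate (env k r) X a (muFormula sub) b η β v value-holds
    s′ = extend suf (proj₁ new , r)
    true′ : True s′ (pos v (fix η X a) Q)
    true′ = unrelocate suf (InScope.scoped (inScope-fix (binder-inScope suf))) _ b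
      (proj₂ (proj₂ (proj₂ new)))

  resolve : ∀ {b c A} → b ≡ c → Holds b A → Holds c A
  resolve refl x = x

  unresolve : ∀ {b c A} → b ≡ c → Holds c A → Holds b A
  unresolve refl x = x

  flipped : ∀ {Q b} → verifies pl Q ≡ b → verifies pl (dual Q) ≡ not b
  flipped {Q} eq = trans (verifies-dual pl Q) (cong not eq)

  Progress : (p : Pos) → Sig L → Set
  Progress p s = Σ[ q ∈ Pos ] (Move p q × Next p q s)

  own-step-as : ∀ s {l} p r → RoleOf p r → InScope l (formula p) (roleI p) →
            verifies pl (roleI p) ≡ isVerifier r → True s p → Progress p s
  own-step-as s (pos v (atom P) Q) _ (atomV ∉V) i eq x = ⊥-elim (∉V (resolve eq x))
  own-step-as s (pos v (atom P) Q) _ (atomR ∈V) i eq x = ⊥-elim (resolve eq x ∈V)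
  own-step-as s (pos v ff Q) _ (ffV ∉W⊥) i eq x = ⊥-elim (∉W⊥ (resolve eq x))
  own-step-as s (pos v ff Q) _ (ffR ∈W⊥) i eq x = ⊥-elim (resolve eq x ∈W⊥)
  own-step-as s (pos v (a ∨ᶠ b) Q) _ ∨V i eq x with resolve eq x
  ... | inj₁ y = _ , ∨l , arrive a s (inScope-∨l i) (s≤s (m≤m+n _ _)) (unresolve eq y)
  ... | inj₂ y = _ , ∨r , arrive b s (inScope-∨r i) (s≤s (m≤n+m _ _)) (unresolve eq y)
  own-step-as s (ipos v a b Q) _ ?V i eq x with em {P = ⟦ a ⟧ (env L s) v}
  ... | yes y = _ , ?r , arrive b s (inScope-⇒r i) (s≤s (m≤n+m _ _)) (unresolve eq (resolve eq x y))
  ... | no ¬y = _ , ?l , arrive a s (inScope-⇒l i) (s≤s (m≤m+n _ _)) (unresolve (flipped eq) ¬y)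
  own-step-as s (dpos v a Q) _ ◇̂V i eq x with resolve eq x
  ... | u , vRu , y = _ , ◇̂m vRu , arrive a s (inScope-◇ i) ≤-refl (unresolve eq y)
  own-step-as s (pos v (fix μ X a) Q) _ μV i eq x =
    _ , unfold , arrive a s (inScope-fix i) ≤-refl x
  own-step-as s (pos v (fix ν X a) Q) _ νR i eq x =
    _ , unfold , arrive a s (inScope-fix i) ≤-refl x
  own-step-as s (pos v (var X) Q) _ (varμ t) i eq x = _ , regen t , regenerated s i t x
  own-step-as s (pos v (var X) Q) _ (varν t) i eq x = _ , regen t , regenerated s i t x
  own-step-as s (pos v (a ∧ᶠ b) Q) _ ∧R i eq x with em {P = ⟦ a ⟧ (env L s) v}
  ... | yes y = _ , ∧r , arrive b s (inScope-∧r i) (s≤s (m≤n+m _ _)) (unresolve eq λ z → resolve eq x (y , z))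
  ... | no ¬y = _ , ∧l , arrive a s (inScope-∧l i) (s≤s (m≤m+n _ _)) (unresolve eq ¬y)
  own-step-as s (pos v (a ⇒ᶠ b) Q) _ ⇒R i eq x
    with em {P = Σ[ u ∈ W ] (v ≼ u × ¬ (⟦ a ⟧ (env L s) u → ⟦ b ⟧ (env L s) u))}
  ... | yes (u , v≼u , ¬y) = _ , ⇒m v≼u , s , unresolve eq ¬y , keep ≤-refl refl
  ... | no ∄u = ⊥-elim (resolve eq x λ u v≼u → stable λ ¬y → ∄u (u , v≼u , ¬y))
  own-step-as s (pos v (□ᶠ a) Q) _ □R i eq x
    with em {P = Σ[ u ∈ W ] Σ[ t ∈ W ] (v ≼ u × R u t × ¬ ⟦ a ⟧ (env L s) t)}
  ... | yes (u , t , v≼u , uRt , ¬y) =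
    _ , □m v≼u uRt , arrive a s (inScope-□ i) ≤-refl (unresolve eq ¬y)
  ... | no ∄t =
    ⊥-elim (resolve eq x λ u t v≼u uRt → stable λ ¬y → ∄t (u , t , v≼u , uRt , ¬y))
  own-step-as s (pos v (◇ᶠ a) Q) _ ◇R i eq x
    with em {P = Σ[ u ∈ W ] (v ≼ u × ¬ (Σ[ t ∈ W ] (R u t × ⟦ a ⟧ (env L s) t)))}
  ... | yes (u , v≼u , ¬y) = _ , ◇m v≼u , s , unresolve eq ¬y , keep ≤-refl refl
  ... | no ∄u = ⊥-elim (resolve eq x λ u v≼u → stable λ ¬y → ∄u (u , v≼u , ¬y))

  own-step : ∀ p s → Occurs p → Owns pl p → True s p → Progress p s
  own-step p s (_ , i) (r , role , owner) = own-step-as s p r role i (verifies-owner (roleI p) r owner)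

  opponent-step-as : ∀ s {l p q r} → Move p q → RoleOf p r → InScope l (formula p) (roleI p) →
            verifies pl (roleI p) ≡ not (isVerifier r) → True s p → Next p q s
  opponent-step-as s ∨l ∨V i eq ¬x = arrive _ s (inScope-∨l i) (s≤s (m≤m+n _ _)) (unresolve eq (resolve eq ¬x ∘ inj₁))
  opponent-step-as s ∨r ∨V i eq ¬x = arrive _ s (inScope-∨r i) (s≤s (m≤n+m _ _)) (unresolve eq (resolve eq ¬x ∘ inj₂))
  opponent-step-as s ?l ?V i eq ¬f = arrive _ s (inScope-⇒l i) (s≤s (m≤m+n _ _))
    (unresolve (flipped eq) (stable λ ¬y → resolve eq ¬f (⊥-elim ∘ ¬y)))
  opponent-step-as s ?r ?V i eq ¬f = arrive _ s (inScope-⇒r i) (s≤s (m≤n+m _ _))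
    (unresolve eq λ y → resolve eq ¬f λ _ → y)
  opponent-step-as s (◇̂m vRu) ◇̂V i eq ¬x =
    arrive _ s (inScope-◇ i) ≤-refl (unresolve eq λ y → resolve eq ¬x (_ , vRu , y))
  opponent-step-as s unfold    _  i eq x = arrive _ s (inScope-fix i) ≤-refl x
  opponent-step-as s (regen t) _  i eq x = regenerated s i t x
  opponent-step-as s ∧l ∧R i eq x = arrive _ s (inScope-∧l i) (s≤s (m≤m+n _ _)) (unresolve eq (proj₁ (resolve eq x)))
  opponent-step-as s ∧r ∧R i eq x = arrive _ s (inScope-∧r i) (s≤s (m≤n+m _ _)) (unresolve eq (proj₂ (resolve eq x)))
  opponent-step-as s (⇒m v≼u) ⇒R i eq f = s , unresolve eq (resolve eq f _ v≼u) , keep ≤-refl refl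
  opponent-step-as s (□m v≼u uRt) □R i eq f =
    arrive _ s (inScope-□ i) ≤-refl (unresolve eq (resolve eq f _ _ v≼u uRt))
  opponent-step-as s (◇m v≼u) ◇R i eq f = s , unresolve eq (resolve eq f _ v≼u) , keep ≤-refl refl

  opponent-step : ∀ {p q} s → Occurs p → Owns (other pl) p → Move p q → True s p → Next p q s
  opponent-step {p} s (_ , i) (r , role , owner) m =
    opponent-step-as s m role i (verifies-opponent (roleI p) r owner)

-- Runs and winning strategies

module Runs (em : ExcludedMiddle 0ℓ) {Prop Var : Set} (_≟_ : DecidableEquality Var)
  (M : CKModel Prop) (w : CKModel.W M) (φ : Fm Prop Var) (muFormula : MuFormula φ)
  (sentence : Sentence φ) (unique : Unique (binders φ)) where

  open Classical em
  open Scoping _≟_ φ muFormula sentence unique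
  open Game M φ w
  open Arena _≟_ M w φ muFormula sentence unique

  module InfiniteRun (f : ℕ → Pos) (run : InfRun f) where

    reach : ∀ i → Reach (f i)
    reach zero    = subst Reach (sym (proj₁ run)) reach0
    reach (suc i) = step (reach i) (proj₂ run i)

    -- Every other move lowers `weight`, so the weight at N bounds the wait.
    next-regeneration : ∀ N → Σ[ n ∈ ℕ ] (N ≤ n × Σ[ e ∈ _ ] Σ[ k ∈ _ ]
      (Suffix (e ∷ k) L × Regen f n (fixOf e)))
    next-regeneration N = search (weight (f N)) N ≤-refl
      where
      search : ∀ m N → weight (f N) ≤ m → Σ[ n ∈ ℕ ] (N ≤ n × Σ[ e ∈ _ ] Σ[ k ∈ _ ]
        (Suffix (e ∷ k) L × Regen f n (fixOf e)))
      search m N le with classify (proj₂ run N)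
      search m N le | inj₂ (v , X , Q , η , a , t , eq , eq′) with binder-of-⊑ t
      ... | Q′ , k , p =
        N , ≤-refl , binder η X a Q′ , k , p , (v , X , Q , η , a , refl , eq , eq′)
      search zero N le | inj₁ (_ , lt) with () ← ≤-trans lt le
      search (suc m) N le | inj₁ (_ , lt) with search m (suc N) (s≤s⁻¹ (≤-trans lt le))
      ... | n , N<n , r = n , <⇒≤ N<n , r

    -- The list is finite, so the times at which non-recurring binders fall silent have a maximum;
    -- beyond it a single regeneration proves recurrence.
    settle : ∀ k → Σ[ N ∈ ℕ ] (∀ {e j} → Suffix (e ∷ j) k → ∀ {n} → N ≤ n →
                               Regen f n (fixOf e) → InfRegen f (fixOf e))
    settle []      = 0 , λ ()
    settle (e ∷ k) with settle k | em {P = Σ[ N ∈ ℕ ] (∀ n → N ≤ n → ¬ Regen f n (fixOf e))}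
    ... | N , h | yes (N′ , never) = N ⊔ N′ , λ where
      here      le r → ⊥-elim (never _ (≤-trans (m≤n⊔m N N′) le) r)
      (there p) le r → h p (≤-trans (m≤m⊔n N N′) le) r
    ... | N , h | no always = N , λ where
      here      _  _ → λ N′ → stable λ ∄n → always (N′ , λ n le r → ∄n (n , le , r))
      (there p) le r → h p le r

    -- Selects the recurring binder that is earliest in preorder. That it encloses the other
    -- recurring ones does not follow from the listing and is obtained from `inside`.
    outermost : ∀ k →
      (Σ[ e ∈ _ ] Σ[ j ∈ _ ] (Suffix (e ∷ j) k × InfRegen f (fixOf e)
        × (∀ {e′ j′} → Suffix (e′ ∷ j′) j → ¬ InfRegen f (fixOf e′))))
      ⊎ (∀ {e j} → Suffix (e ∷ j) k → ¬ InfRegen f (fixOf e))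
    outermost []      = inj₂ λ ()
    outermost (e ∷ k) with outermost k | em {P = InfRegen f (fixOf e)}
    ... | inj₁ (e′ , j , p , r) | _     = inj₁ (e′ , j , there p , r)
    ... | inj₂ none | yes inf = inj₁ (e , k , here , inf , none)
    ... | inj₂ none | no ¬inf = inj₂ λ where
      here      → ¬inf
      (there p) → none p

    record Dominant : Set where
      field
        {e}       : Binder Prop Var
        {l}       : List (Binder Prop Var)
        suf       : Suffix (e ∷ l) L
        recurs    : InfRegen f (fixOf e)
        from      : ℕ
        regenFrom : Regen f from (fixOf e)
        inside    : ∀ {m} → from < m → formula (f m) ⊑ fixOf e

    -- After a late regeneration of `e` the play cannot leave `fixOf e`: only regenerating a
    -- variable free in it would do so. The binder of that variable lies in `l`, and by `settle` it
    -- would recur, against the choice of `e`.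
    dominant : Dominant
    dominant with outermost L | settle L
    ... | inj₂ none | N , settled with next-regeneration N
    ... | n , le , e , k , p , r = ⊥-elim (none p (settled p le r))
    dominant | inj₁ (e , l , suf , recurs , outer) | N , settled with recurs N
    ... | n₀ , N≤n₀ , r₀@(_ , _ , _ , _ , _ , _ , _ , after₀) = record
      { suf = suf ; recurs = recurs ; from = n₀ ; regenFrom = r₀ ; inside = inside }
      where
      inside : ∀ {m} → n₀ < m → formula (f m) ⊑ fixOf e
      inside {suc m} n₀<1+m with m≤n⇒m<n∨m≡n (s≤s⁻¹ n₀<1+m)
      inside {suc m} _ | inj₂ refl = subst (λ p → formula p ⊑ fixOf e) (sym after₀) here
      inside {suc m} _ | inj₁ n₀<m with classify (proj₂ run m)
      ... | inj₁ (sub , _) = ⊑-trans sub (inside n₀<m)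
      ... | inj₂ (v , X , Q , η , a , t , before , after)
        with free-or-bound _≟_ (subst (λ p → formula p ⊑ fixOf e) before (inside n₀<m))
      ...   | inj₂ (η′ , a′ , t′) = subst (_⊑ fixOf e) (trans
                (fix-unique (⊑-trans t′ (InScope.sub (binder-inScope suf))) t)
                (sym (cong formula after))) t′
      ...   | inj₁ (p , o) with InScope.scoped (binder-inScope suf) o | binder-of-⊑ t
      ...     | e′ , k , q , refl , _ | Q′ , k′ , q′
        with L-unique (suffix-trans q (suffix-tail suf)) q′ refl
      ...     | refl = ⊥-elim (outer q (settled q′ (≤-trans N≤n₀ (<⇒≤ n₀<m))
                  (v , X , Q , η , a , refl , before , after)))

    module _ (D : Dominant) where
      open Dominant D

      dominates : ∀ θ → InfRegen f θ → θ ⊑ fixOf e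
      dominates θ inf with inf (suc from)
      ... | m , lt , (v , X , Q , η , a , eq , _ , after) =
        subst (λ p → formula p ⊑ fixOf e) after (inside (m≤n⇒m≤1+n lt))

      owned : ∀ pl → ¬ Losing (verifies pl (role e)) (fp e) → OwnsFP (fixOf e) pl
      owned pl ¬losing with regenFrom
      ... | v , X , Q , η , a , refl , _ , after = go pl e suf ¬losing reached
        where
        reached : Reach (pos v (fix η X a) Q)
        reached = subst Reach after (reach (suc from))
        go : ∀ pl g → Suffix (g ∷ l) L → ¬ Losing (verifies pl (role g)) (fp g) →
             Reach (pos v (fixOf g) Q) → OwnsFP (fixOf g) pl
        go pl g p ¬lose r with inScope-role p (proj₂ (occurs-reach r))
        go I  (binder ν _ _ Vᵣ) p ¬lose r | refl = _ , _ , r , νV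
        go I  (binder μ _ _ Rᵣ) p ¬lose r | refl = _ , _ , r , μR
        go I  (binder μ _ _ Vᵣ) p ¬lose r | refl = ⊥-elim (¬lose tt)
        go I  (binder ν _ _ Rᵣ) p ¬lose r | refl = ⊥-elim (¬lose tt)
        go II (binder ν _ _ Vᵣ) p ¬lose r | refl = ⊥-elim (¬lose tt)
        go II (binder μ _ _ Rᵣ) p ¬lose r | refl = ⊥-elim (¬lose tt)
        go II (binder μ _ _ Vᵣ) p ¬lose r | refl = λ where
          (_ , _ , r′ , μR) → contradiction (inScope-role p (proj₂ (occurs-reach r′))) λ ()
        go II (binder ν _ _ Rᵣ) p ¬lose r | refl = λ where
          (_ , _ , r′ , νV) → contradiction (inScope-role p (proj₂ (occurs-reach r′))) λ ()

-- The strategy of least signatures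

module Winning (em : ExcludedMiddle 0ℓ) {Prop Var : Set} (_≟_ : DecidableEquality Var)
  (M : CKModel Prop) (w : CKModel.W M) (φ : Fm Prop Var) (muFormula : MuFormula φ)
  (sentence : Sentence φ) (unique : Unique (binders φ)) (pl : Player) where

  open Classical em
  open Scoping _≟_ φ muFormula sentence unique
  open Signatures em _≟_ M pl
  open Game M φ w
  open Arena _≟_ M w φ muFormula sentence unique
  open Truth em _≟_ M w φ muFormula sentence unique pl
  open Runs em _≟_ M w φ muFormula sentence unique

  Satisfied : Pos → Set
  Satisfied p = Σ[ s ∈ Sig L ] True s p

  Best : Pos → Sig L → Set
  Best p = Minimal (order L) (λ s → True s p)

  best : ∀ p → Satisfied p → Σ (Sig L) (Best p)
  best p = minimum (order L) (λ s → True s p)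

  -- Least signatures are unique only up to equivalence, so some minimal `s` is allowed here in
  -- place of the one chosen by `best`.
  Good : Pos → Pos → Set
  Good p q = Σ[ s ∈ Sig L ] (Best p s × Next p q s)

  -- The second case serves positions without a good move, where a strategy still owes an admissible
  -- one; the last is a filler at dead ends.
  strategy : Pos → Pos
  strategy p with em {P = Σ[ q ∈ Pos ] (Move p q × Good p q)} | em {P = Σ[ q ∈ Pos ] Move p q}
  ... | yes (q , _) | _           = q
  ... | no _        | yes (q , _) = q
  ... | no _        | no _        = p

  strategy-move : ∀ p → Σ[ q ∈ Pos ] Move p q → Move p (strategy p)
  strategy-move p m with em {P = Σ[ q ∈ Pos ] (Move p q × Good p q)} | em {P = Σ[ q ∈ Pos ] Move p q}
  ... | yes (_ , n , _) | _           = n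
  ... | no _            | yes (_ , n) = n
  ... | no _            | no ¬m       = ⊥-elim (¬m m)

  strategy-good : ∀ p → Occurs p → Owns pl p → Satisfied p → Good p (strategy p)
  strategy-good p o own x with em {P = Σ[ q ∈ Pos ] (Move p q × Good p q)}
  ... | yes (_ , _ , g) = g
  ... | no ¬g with best p x
  ...   | s , b with own-step p s o own (proj₁ b)
  ...     | q , m , n = ⊥-elim (¬g (q , m , s , b , n))

  good-step : ∀ {p q} → Occurs p → Satisfied p → Move p q → (Owns pl p → q ≡ strategy p) → Good p q
  good-step {p} {q} o x m follows = split (owner-exists em pl p o)
    where
    split : Owns pl p ⊎ Owns (other pl) p → Good p q
    split (inj₁ own) = subst (Good p) (sym (follows own)) (strategy-good p o own x)
    split (inj₂ opp) with best p x
    ... | s , b = s , b , opponent-step s o opp m (proj₁ b)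

  module _ (satisfied-start : Satisfied start) where

    along : ∀ n f → f 0 ≡ start → (∀ i → i < n → Move (f i) (f (suc i))) →
            FollowsFin pl strategy n f → Occurs (f n) × Satisfied (f n)
    along zero    f eq mv fo = subst (λ p → Occurs p × Satisfied p) (sym eq)
      (occurs-start , satisfied-start)
    along (suc n) f eq mv fo with along n f eq (λ i lt → mv i (m≤n⇒m≤1+n lt)) (λ i lt → fo i (m≤n⇒m≤1+n lt))
    ... | o , x with good-step o x (mv n ≤-refl) (fo n ≤-refl)
    ...   | _ , _ , s′ , y , _ = occurs-move o (mv n ≤-refl) , s′ , y

    wins-finite : ∀ n f → FinRun n f → FollowsFin pl strategy n f → WinsFin pl n f
    wins-finite n f (eq , mv , stuck) fo with along n f eq mv fo
    ... | o , s , x with owner-exists em pl (f n) o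
    ...   | inj₂ opp = opp
    ...   | inj₁ own with own-step (f n) s o own x
    ...     | q , m , _ = ⊥-elim (stuck (q , m))

    module _ (f : ℕ → Pos) (run : InfRun f) (fo : FollowsInf pl strategy f) where
      open InfiniteRun f run

      satisfied : ∀ i → Satisfied (f i)
      satisfied i = proj₂ (along i f (proj₁ run) (λ j _ → proj₂ run j) (λ j _ → fo j))

      good : ∀ i → Good (f i) (f (suc i))
      good i = good-step (occurs-reach (reach i)) (satisfied i) (proj₂ run i) (fo i)

      open Dominant dominant

      K : List (Binder Prop Var)
      K = e ∷ l

      module K = Order K

      -- Components after that of `e` are cut off, since entering a fixed point inside `fixOf e` may
      -- raise them.
      rank : ℕ → Sig K
      rank i = restrict suf (proj₁ (best (f i) (satisfied i)))

      -- A fixed point properly inside `fixOf e` has all of `K` in its tail, so a comparison of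
      -- tails projects to `K`.
      enters-inside : ∀ {e′ l′ s s′} → fixOf e′ ⊑ fixOf e → (i : Suffix (e′ ∷ l′) L) →
        (fixOf e′ ≢ fixOf e → Order._≼_ l′ (restrict (suffix-tail i) s′) (restrict (suffix-tail i) s)) →
        (fixOf e′ ≡ fixOf e → restrict suf s′ K.≼ restrict suf s) →
        restrict suf s′ K.≼ restrict suf s
      enters-inside here     i inner outer = outer refl
      enters-inside {s = s} {s′} (fixs t) i inner outer with collected (role e) K t
      ... | Q , k , p , q with L-unique (suffix-trans p (InScope.suffix (binder-inScope suf))) i refl
      ... | refl = subst (λ h → restrict h s′ K.≼ restrict h s)
        (suffix-irrelevant (suffix-trans q (suffix-tail i)) suf)
        (subst (λ x → x K.≼ restrict (suffix-trans q (suffix-tail i)) s)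
          (sym (restrict-trans q (suffix-tail i) s′))
          (subst (restrict q (restrict (suffix-tail i) s′) K.≼_)
            (sym (restrict-trans q (suffix-tail i) s))
            (restrict-mono q (inner λ eq → <-irrefl (cong size eq) (s≤s (size-mono t))))))

      change-≼ : ∀ {p q s s′} → Change p q s s′ → formula p ⊑ fixOf e → formula q ⊑ fixOf e →
                 restrict suf s′ K.≼ restrict suf s
      change-≼ (keep _ refl) _ _ = K.≼-refl
      -- `fixOf e` itself cannot be entered anew: p lies inside it, and a descending move would have
      -- to reach a position at least as heavy.
      change-≼ {p} {q} (enter lt eq i le) p⊑ q⊑ =
        enters-inside (subst (_⊑ fixOf e) eq q⊑) i (λ _ → le) λ eq′ →
          ⊥-elim (<-irrefl (trans (weight-fix q eq) (cong size (trans eq eq′)))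
            (<-≤-trans lt (≤-trans (weight≤size p) (size-mono p⊑))))
      change-≼ {s = s} {s′} (regen {e′} {l′} eq i le _) p⊑ q⊑ =
        enters-inside (subst (_⊑ fixOf e) eq q⊑) i
          (λ _ → subst (λ x → Order._≼_ l′ x (restrict (suffix-tail i) s))
            (sym (restrict-trans {l′} {e′ ∷ l′} (there here) i s′))
            (subst (λ x → Order._≼_ l′ (restrict {l′} {e′ ∷ l′} (there here) (restrict i s′)) x)
              (sym (restrict-trans {l′} {e′ ∷ l′} (there here) i s))
              (restrict-mono {l′} {e′ ∷ l′} (there here) le)))
          same
        where
        same : fixOf e′ ≡ fixOf e → restrict suf s′ K.≼ restrict suf s
        same eq′ with L-unique i suf (fix-injective-bv eq′)
        ... | refl = le

      change-≺ : ∀ {v X Q s s′} → Losing (verifies pl (role e)) (fp e) →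
                 Change (pos v (var X) Q) (pos v (fixOf e) Q) s s′ →
                 restrict suf s′ K.≺ restrict suf s
      change-≺ losing (keep (s≤s ()) _)
      change-≺ losing (enter (s≤s ()) _ _ _)
      change-≺ losing (regen eq i _ lt) with L-unique suf i (fix-injective-bv eq)
      ... | refl = lt losing

      -- The best signature at the next position is below `s′`, which on `K` is below `s`; and `s`
      -- is below the chosen one at the current position because both are minimal.
      rank-step : ∀ {m} → from < m → rank (suc m) K.≼ rank m
      rank-step {m} lt with good m
      ... | s , (x , least) , s′ , y , c = K.≼-trans
        (restrict-mono suf (proj₂ (proj₂ (best (f (suc m)) (satisfied (suc m)))) s′ y))
        (K.≼-trans (change-≼ c (inside lt) (inside (m≤n⇒m≤1+n lt)))
          (restrict-mono suf (least _ (proj₁ (proj₂ (best (f m) (satisfied m)))))))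

      rank-regen : ∀ {m} → Losing (verifies pl (role e)) (fp e) → Regen f m (fixOf e) →
                   rank (suc m) K.≺ rank m
      rank-regen {m} losing (v , X , Q , _ , _ , refl , before , after) with good m
      ... | s , (x , least) , s′ , y , c = K.≼-≺-trans
        (restrict-mono suf (proj₂ (proj₂ (best (f (suc m)) (satisfied (suc m)))) s′ y))
        (K.≺-≼-trans
          (change-≺ losing (subst₂ (λ p q → Change p q s s′) before after c))
          (restrict-mono suf (least _ (proj₁ (proj₂ (best (f m) (satisfied m)))))))

      rank-mono : ∀ {m n} → from < m → m ≤ n → rank n K.≼ rank m
      rank-mono {n = n} lt le with m≤n⇒m<n∨m≡n le
      ... | inj₂ refl = K.≼-refl
      rank-mono {n = suc n} lt le | inj₁ (s≤s m≤n) =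
        K.≼-trans (rank-step (<-≤-trans lt m≤n)) (rank-mono lt m≤n)

      no-descent : ∀ {m} → Losing (verifies pl (role e)) (fp e) → from < m → Acc K._≺_ (rank m) → ⊥
      no-descent {m} losing lt (acc rs) with recurs m
      ... | n , m≤n , r = no-descent losing (m≤n⇒m≤1+n (<-≤-trans lt m≤n))
        (rs (K.≺-≼-trans (rank-regen losing r) (rank-mono lt m≤n)))

      wins-infinite : WinsInf pl f
      wins-infinite = fixOf e , recurs , dominates dominant ,
        owned dominant pl λ losing → no-descent losing ≤-refl (K.wf (rank (suc from)))

    hasWinningStrategy : HasWinningStrategy pl
    hasWinningStrategy = strategy , (λ p _ _ → strategy-move p) , wins-finite , wins-infinite

  hasWinningStrategy-if : Holds (verifies pl Vᵣ) (Semantics._⊨_ _≟_ M w φ) → HasWinningStrategy pl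
  hasWinningStrategy-if x
    -- □ᶠ φ is a dummy predecessor of the start position.
    with arrive {pos w (□ᶠ φ) Vᵣ} φ _ inScope-φ ≤-refl
      (unrelocate (suffix-[] L) (InScope.scoped inScope-φ) tt (verifies pl Vᵣ) x)
  ... | s , y , _ = hasWinningStrategy (s , y)

-- Incompatibility of winning strategies for both players

module Converse (em : ExcludedMiddle 0ℓ) {Prop Var : Set} (_≟_ : DecidableEquality Var)
  (M : CKModel Prop) (w : CKModel.W M) (φ : Fm Prop Var) (muFormula : MuFormula φ)
  (sentence : Sentence φ) (unique : Unique (binders φ)) where

  open Classical em
  open Game M φ w
  open Arena _≟_ M w φ muFormula sentence unique

  module _ (σ τ : Pos → Pos) where

    Live : Pos → Set
    Live p = Σ[ q ∈ Pos ] Move p q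

    respond : Pos → Pos
    respond p with em {P = Owns I p}
    ... | yes _ = σ p
    ... | no _  = τ p

    respond-I : ∀ p → Owns I p → respond p ≡ σ p
    respond-I p own with em {P = Owns I p}
    ... | yes _   = refl
    ... | no ¬own = ⊥-elim (¬own own)

    respond-II : ∀ p → Owns II p → respond p ≡ τ p
    respond-II p own with em {P = Owns I p}
    ... | yes own′ = ⊥-elim (owner-unique own′ own)
    ... | no _     = refl

    play : ℕ → Pos
    play zero    = start
    play (suc i) = respond (play i)

    module _ (strategyI : Strategy I σ) (strategyII : Strategy II τ) where

      respond-move : ∀ p → Occurs p → Live p → Move p (respond p)
      respond-move p o live with owner-exists em I p o
      ... | inj₁ own = subst (Move p) (sym (respond-I p own))
                         (strategyI p (occurs-inGame p o) own live)
      ... | inj₂ own = subst (Move p) (sym (respond-II p own))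
                         (strategyII p (occurs-inGame p o) own live)

      play-moves : ∀ n → (∀ i → i < n → Live (play i)) →
                   Occurs (play n) × (∀ i → i < n → Move (play i) (play (suc i)))
      play-moves zero    live = occurs-start , λ _ ()
      play-moves (suc n) live with play-moves n (λ i lt → live i (m≤n⇒m≤1+n lt))
      ... | o , mv = occurs-move o last , moves
        where
        last : Move (play n) (play (suc n))
        last = respond-move (play n) o (live n ≤-refl)
        moves : ∀ i → i < suc n → Move (play i) (play (suc i))
        moves i (s≤s le) with m≤n⇒m<n∨m≡n le
        ... | inj₁ lt   = mv i lt
        ... | inj₂ refl = last

      stuck-or-live : ∀ n → (Σ[ m ∈ ℕ ] ((∀ i → i < m → Live (play i)) × ¬ Live (play m)))
                            ⊎ (∀ i → i < n → Live (play i))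
      stuck-or-live zero    = inj₂ λ _ ()
      stuck-or-live (suc n) with stuck-or-live n | em {P = Live (play n)}
      ... | inj₁ stuck | _         = inj₁ stuck
      ... | inj₂ live  | no ¬live  = inj₁ (n , live , ¬live)
      ... | inj₂ live  | yes liveₙ = inj₂ λ where
        i (s≤s le) → [ live i , (λ { refl → liveₙ }) ]′ (m≤n⇒m<n∨m≡n le)

  -- Let σ and τ play against each other. The run ends at a position that both players would own, or
  -- else its outermost recurring fixed point, unique by antisymmetry of `⊑`, would have both
  -- owners.
  not-both : HasWinningStrategy I → HasWinningStrategy II → ⊥
  not-both (σ , sσ , finσ , infσ) (τ , sτ , finτ , infτ)
    with em {P = Σ[ m ∈ ℕ ] ((∀ i → i < m → Live σ τ (play σ τ i)) × ¬ Live σ τ (play σ τ m))}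
  ... | yes (n , live , stuck) = owner-unique
      (finτ n f run λ i _ → respond-II σ τ (f i))
      (finσ n f run λ i _ → respond-I σ τ (f i))
    where
    f = play σ τ
    run : FinRun n f
    run = refl , proj₂ (play-moves σ τ sσ sτ n live) , stuck
  ... | no ¬stuck = clash
      (infσ f run λ i → respond-I σ τ (f i))
      (infτ f run λ i → respond-II σ τ (f i))
    where
    f = play σ τ
    live : ∀ n i → i < n → Live σ τ (f i)
    live n = [ (λ stuck → ⊥-elim (¬stuck stuck)) , id ]′ (stuck-or-live σ τ sσ sτ n)
    run : InfRun f
    run = refl , λ i → proj₂ (play-moves σ τ sσ sτ (suc i) (live (suc i))) i ≤-refl
    clash : WinsInf I f → WinsInf II f → ⊥
    clash (θ , inf , top , own) (θ′ , inf′ , top′ , ¬own)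
      with ⊑-antisym (top θ′ inf′) (top′ θ inf)
    ... | refl = ¬own own

mainTheorem2 : ExcludedMiddle 0ℓ →
    {Prop Var : Set} (_≟_ : DecidableEquality Var)
    (M : CKModel Prop) (w : CKModel.W M) (φ : Fm Prop Var) →
    MuFormula φ → Sentence φ → WellNamed φ →
    (Game.HasWinningStrategy M φ w I ⇔ Semantics._⊨_ _≟_ M w φ)
    × (Game.HasWinningStrategy M φ w II ⇔ (¬ Semantics._⊨_ _≟_ M w φ))
mainTheorem2 em _≟_ M w φ muFormula sentence (_ , unique) =
  mk⇔ (λ winI → stable λ ⊭φ → not-both winI (winII ⊭φ)) winI ,
  mk⇔ (λ winII ⊨φ → not-both (winI ⊨φ) winII) winII
  where
  open Classical em
  open Converse em _≟_ M w φ muFormula sentence unique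
  open Game M φ w
  winI : Semantics._⊨_ _≟_ M w φ → HasWinningStrategy I
  winI = Winning.hasWinningStrategy-if em _≟_ M w φ muFormula sentence unique I
  winII : ¬ Semantics._⊨_ _≟_ M w φ → HasWinningStrategy II
  winII = Winning.hasWinningStrategy-if em _≟_ M w φ muFormula sentence unique II
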